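{- Let $G$ be a graph on $n\ge 2$ vertices with $m\ge1$ edges whose line graph is $r$-regular. Then $G$ is eligible and $$\operatorname{mv}(G) = \frac{m(4+r)}{n-1} - \left(\frac{2m}{n-1}\right)^2.$$
   Context: Graphs are finite and simple. For a graph $G$ on $n$ vertices, $\mathcal{S}_L(G)$ denotes the set of $n\times n$ real symmetric matrices $A=[a_{i,j}]$ such that $a_{i,j}<0$ if $\{i,j\}\in E(G)$, $a_{i,j}=0$ if $i\neq j$ and $\{i,j\}\notin E(G)$, and $a_{i,i}=-\sum_{k\neq i}a_{i,k}$ for all $i$. Let $\mathcal{S}^s_L(G)=\{A\in\mathcal{S}_L(G):\operatorname{tr}(A)=2|E(G)|\}$. For $A\in\mathcal{S}_L(G)$ with spectrum $\{0,\lambda_2,\ldots,\lambda_n\}$ put $\mathbb{E}(A)=\frac{1}{n-1}\sum_{i=2}^n\lambda_i$ and $\operatorname{Var}(A)=\frac{1}{n-1}\sum_{i=2}^n(\lambda_i-\mathbb{E}(A))^2$. The minimum variance of $G$ is $\operatorname{mv}(G)=\inf\{\operatorname{Var}(A):A\in\mathcal{S}^s_L(G)\}$. The line graph of $G$ has vertex set $E(G)$, two distinct edges being adjacent when they share a vertex. Let $M_2=4I+B$, where $B$ is the adjacency matrix of the line graph of $G$ ($M_2$ is positive definite). $G$ is called eligible if $M_2^{ -1}\mathbf{1}$ is entrywise positive, where $\mathbf{1}$ is the all-ones vector. -}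

module Defs where

open import Level using (0ℓ)
open import Algebra.Bundles using (CommutativeRing)
open import Data.Nat.Base as ℕ using (ℕ; suc)
open import Data.Fin.Base as Fin using (Fin; zero; suc)
import Data.Fin.Properties as Fin
open import Data.List.Base using (List; length; filter; lookup; allFin; cartesianProduct)
open import Data.Product.Base using (Σ-syntax; ∃-syntax; _×_; _,_)
open import Data.Sum.Base using (_⊎_; inj₁; inj₂)
open import Data.Vec.Functional using (Vector; _∷_)
open import Relation.Binary.Core using (Rel)
open import Relation.Binary.Definitions using (Decidable; Symmetric; Irreflexive)
open import Relation.Binary.Structures using (IsStrictTotalOrder)
open import Relation.Binary.PropositionalEquality.Core using (_≡_; _≢_; refl; sym)
open import Relation.Nullary.Decidable using (yes; no; _×-dec_; _⊎-dec_; ¬?)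
open import Relation.Nullary.Negation using (¬_)
open import Relation.Unary using (Pred)

record Graph (n : ℕ) : Set₁ where
  field
    Adj    : Rel (Fin n) 0ℓ
    Adj?   : Decidable Adj
    symm   : Symmetric Adj
    irrefl : Irreflexive _≡_ Adj

  neighbours : Fin n → List (Fin n)
  neighbours u = filter (Adj? u) (allFin n)

  degree : Fin n → ℕ
  degree u = length (neighbours u)

  -- The edge {i , j} is listed once, as the pair (i , j) with i < j.
  edges : List (Fin n × Fin n)
  edges = filter (λ (i , j) → (i Fin.<? j) ×-dec Adj? i j)
                 (cartesianProduct (allFin n) (allFin n))

  numEdges : ℕ
  numEdges = length edges

Regular : ∀ {n} → ℕ → Graph n → Set
Regular r G = ∀ u → Graph.degree G u ≡ r

ShareVertex : ∀ {n} → Rel (Fin n × Fin n) 0ℓ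
ShareVertex (i , j) (k , l) = (i ≡ k ⊎ i ≡ l) ⊎ (j ≡ k ⊎ j ≡ l)

shareVertex? : ∀ {n} → Decidable (ShareVertex {n})
shareVertex? (i , j) (k , l) =
  ((i Fin.≟ k) ⊎-dec (i Fin.≟ l)) ⊎-dec ((j Fin.≟ k) ⊎-dec (j Fin.≟ l))

shareVertex-sym : ∀ {n} → Symmetric (ShareVertex {n})
shareVertex-sym (inj₁ (inj₁ p)) = inj₁ (inj₁ (sym p))
shareVertex-sym (inj₁ (inj₂ p)) = inj₂ (inj₁ (sym p))
shareVertex-sym (inj₂ (inj₁ p)) = inj₁ (inj₂ (sym p))
shareVertex-sym (inj₂ (inj₂ p)) = inj₂ (inj₂ (sym p))

-- Vertices are positions in the repetition-free list of edges, so distinct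
-- positions are distinct edges.
lineGraph : ∀ {n} (G : Graph n) → Graph (Graph.numEdges G)
lineGraph G = record
  { Adj    = λ e f → e ≢ f × ShareVertex (lookup edges e) (lookup edges f)
  ; Adj?   = λ e f → ¬? (e Fin.≟ f) ×-dec shareVertex? (lookup edges e) (lookup edges f)
  ; symm   = λ (e≢f , s) → (λ f≡e → e≢f (sym f≡e)) , shareVertex-sym s
  ; irrefl = λ e≡f (e≢f , _) → e≢f e≡f
  }
  where open Graph G

-- The axioms characterising the real numbers up to isomorphism; equality is
-- the setoid equality _≈_ of the underlying ring.
record CompleteOrderedField : Set₁ where
  infix  4 _<_ _≤_
  infix  8 _⁻¹
  infixl 7 _/_

  field
    commutativeRing : CommutativeRing 0ℓ 0ℓ

  open CommutativeRing commutativeRing public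
    hiding (refl; sym; trans; reflexive; isEquivalence)

  field
    0≉1 : ¬ 0# ≈ 1#

    -- Total by convention: nothing is assumed about 0# ⁻¹.
    _⁻¹         : Carrier → Carrier
    *-inverseʳ  : ∀ x → ¬ x ≈ 0# → x * x ⁻¹ ≈ 1#

    _<_                : Rel Carrier 0ℓ
    isStrictTotalOrder : IsStrictTotalOrder _≈_ _<_
    +-monoʳ-<          : ∀ z {x y} → x < y → z + x < z + y
    *-positive         : ∀ {x y} → 0# < x → 0# < y → 0# < x * y

  _≤_ : Rel Carrier 0ℓ
  x ≤ y = x < y ⊎ x ≈ y

  UpperBound : Pred Carrier 0ℓ → Carrier → Set
  UpperBound S b = ∀ x → S x → x ≤ b

  LowerBound : Pred Carrier 0ℓ → Carrier → Set
  LowerBound S b = ∀ x → S x → b ≤ x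

  IsSupremum : Pred Carrier 0ℓ → Carrier → Set
  IsSupremum S s = UpperBound S s × (∀ b → UpperBound S b → s ≤ b)

  IsInfimum : Pred Carrier 0ℓ → Carrier → Set
  IsInfimum S s = LowerBound S s × (∀ b → LowerBound S b → b ≤ s)

  field
    complete : (S : Pred Carrier 0ℓ) → (∃[ x ] S x) → (∃[ b ] UpperBound S b) →
               (∃[ s ] IsSupremum S s)

  _/_ : Carrier → Carrier → Carrier
  x / y = x * y ⁻¹

module MinimumVariance (ℝ : CompleteOrderedField) where
  open CompleteOrderedField ℝ
  open import Algebra.Properties.CommutativeMonoid.Sum +-commutativeMonoid using (sum)
  open import Algebra.Properties.Monoid.Mult +-monoid using () renaming (_×_ to _·_)

  infix 9 _²

  fromℕ : ℕ → Carrier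
  fromℕ k = k · 1#

  _² : Carrier → Carrier
  x ² = x * x

  Matrix : ℕ → Set
  Matrix n = Fin n → Fin n → Carrier

  1ᴹ : ∀ {n} → Matrix n
  1ᴹ i j with i Fin.≟ j
  ... | yes _ = 1#
  ... | no  _ = 0#

  _*ᴹ_ : ∀ {n} → Matrix n → Matrix n → Matrix n
  (A *ᴹ B) i j = sum λ k → A i k * B k j

  _*ⱽ_ : ∀ {n} → Matrix n → Vector Carrier n → Vector Carrier n
  (A *ⱽ x) i = sum λ k → A i k * x k

  trace : ∀ {n} → Matrix n → Carrier
  trace A = sum λ i → A i i

  IsInverse : ∀ {n} → Matrix n → Matrix n → Set
  IsInverse A B = (∀ i j → (A *ᴹ B) i j ≈ 1ᴹ i j) × (∀ i j → (B *ᴹ A) i j ≈ 1ᴹ i j)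

  combination : ∀ {n k} → Vector Carrier k → (Fin k → Vector Carrier n) → Vector Carrier n
  combination c v i = sum λ j → c j * v j i

  IsBasis : ∀ {n k} → (Fin k → Vector Carrier n) → Set
  IsBasis {n} {k} v =
      ((c : Vector Carrier k) → (∀ i → combination c v i ≈ 0#) → ∀ j → c j ≈ 0#)
    × ((x : Vector Carrier n) → Σ[ c ∈ Vector Carrier k ] (∀ i → combination c v i ≈ x i))

  -- The eigenvalues of A listed with multiplicity, i.e. along a basis of
  -- eigenvectors: μ occurs dim ker (A - μ I) times.  For symmetric A this is
  -- also its multiplicity as a root of the characteristic polynomial.
  IsSpectrum : ∀ {n} → Matrix n → Vector Carrier n → Set
  IsSpectrum {n} A eig =
    Σ[ v ∈ (Fin n → Vector Carrier n) ]
      IsBasis v × (∀ j i → (A *ⱽ v j) i ≈ eig j * v j i)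

  offDiagonalRowSum : ∀ {n} → Matrix n → Fin n → Carrier
  offDiagonalRowSum {n} A i = sum term
    where
    term : Fin n → Carrier
    term k with k Fin.≟ i
    ... | yes _ = 0#
    ... | no  _ = A i k

  record 𝒮ᴸ {n} (G : Graph n) (A : Matrix n) : Set where
    open Graph G
    field
      symmetric : ∀ i j → A i j ≈ A j i
      edge      : ∀ i j → Adj i j → A i j < 0#
      nonEdge   : ∀ i j → i ≢ j → ¬ Adj i j → A i j ≈ 0#
      diagonal  : ∀ i → A i i ≈ - offDiagonalRowSum A i

  𝒮ᴸˢ : ∀ {n} → Graph n → Matrix n → Set
  𝒮ᴸˢ G A = 𝒮ᴸ G A × trace A ≈ fromℕ (2 ℕ.* Graph.numEdges G)

  mean : ∀ {k} → Vector Carrier k → Carrier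
  mean {k} x = sum x / fromℕ k

  variance : ∀ {k} → Vector Carrier k → Carrier
  variance {k} x = sum (λ i → (x i - mean x) ²) / fromℕ k

  -- IsVar A v says Var(A) = v; the n-1 entries of eig are the eigenvalues
  -- λ₂, …, λₙ left after removing one 0 from the spectrum.
  IsVar : ∀ {n-1} → Matrix (suc n-1) → Carrier → Set
  IsVar {n-1} A v =
    Σ[ eig ∈ Vector Carrier n-1 ] IsSpectrum A (0# ∷ eig) × v ≈ variance eig

  -- IsMV G v says mv(G) = v.
  IsMV : ∀ {n-1} → Graph (suc n-1) → Carrier → Set
  IsMV G = IsInfimum (λ v → ∃[ A ] 𝒮ᴸˢ G A × IsVar A v)

  adjacencyMatrix : ∀ {n} → Graph n → Matrix n
  adjacencyMatrix G i j with Graph.Adj? G i j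
  ... | yes _ = 1#
  ... | no  _ = 0#

  M₂ : ∀ {n} (G : Graph n) → Matrix (Graph.numEdges G)
  M₂ G e f = fromℕ 4 * 1ᴹ e f + adjacencyMatrix (lineGraph G) e f

  Eligible : ∀ {n} → Graph n → Set
  Eligible G = ∃[ N ] IsInverse (M₂ G) N × (∀ e → 0# < (N *ⱽ λ _ → 1#) e)

-- With L the Laplacian of G, tr(LA) = ((r + 4)/2) tr A for every A ∈ 𝒮ᴸ G, because
-- d(i) + d(j) = r + 2 along each edge.  So 0 ≤ tr((A - L)²) gives tr(A²) ≥ tr(L²) = m(r + 4)
-- on 𝒮ᴸˢ G, and the variance is tr(A²)/(n-1) - (tr A/(n-1))².
--
-- That L has an eigenbasis at all is the spectral theorem.  No compactness is needed: the
-- supremum μ of the lower Rayleigh bounds of A is an eigenvalue, since A - μ is positive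
-- semidefinite, and if it were invertible it would be coercive and μ could be increased;
-- invertibility is decided by elimination.
--
-- Eligibility: with K the vertex-edge incidence matrix, M₂ = 2I + KᵀK is positive definite,
-- and M₂ 1 = (4 + r) 1.
module Submission where

open import Defs
open import Algebra.Solver.Ring.AlmostCommutativeRing using (_-Raw-AlmostCommutative⟶_; fromCommutativeRing)
import Algebra.Solver.Ring
open import Data.Bool.Base using (true; false; if_then_else_)
open import Data.Fin.Base as Fin using (Fin; zero; suc; punchIn; punchOut)
import Data.Fin.Properties as Fin
open import Data.Integer.Base as ℤ using (ℤ; +_; -[1+_])
import Data.Integer.Properties as ℤ
open import Data.List.Base as List
  using (List; []; _∷_; _++_; length; filter; lookup; tabulate; allFin; cartesianProduct)
open import Data.List.Membership.Propositional.Properties using (∈-lookup; ∈-filter⁻)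
import Data.List.Relation.Unary.All as All
open import Data.List.Relation.Unary.AllPairs using (_∷_)
open import Data.List.Relation.Unary.Unique.Propositional using (Unique)
import Data.List.Relation.Unary.Unique.Propositional.Properties as Unique
open import Data.Maybe.Base using (just; nothing)
open import Data.Nat.Base as ℕ using (ℕ; zero; suc; s≤s)
import Data.Nat.Properties as ℕ
open import Data.Product.Base using (_×_; ∃-syntax; _,_; proj₁; proj₂)
open import Data.Sum.Base using (_⊎_; inj₁; inj₂; [_,_]′)
open import Data.Sum.Effectful.Left using (applicative)
open import Data.Vec.Functional using (Vector; tail) renaming (_∷_ to _∷ⱽ_)
open import Function.Base using (_∘_; _$_)
open import Level using (0ℓ)
open import Relation.Binary.Bundles using (Setoid)
open import Relation.Binary.Definitions using (tri<; tri≈; tri>; WeaklyDecidable)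
open import Relation.Binary.PropositionalEquality.Core as ≡ using (_≡_; _≢_)
open import Relation.Binary.Structures using (IsStrictTotalOrder)
open import Relation.Nullary.Decidable using (Dec; yes; no; does; _×-dec_; _⊎-dec_)
open import Relation.Nullary.Negation using (¬_; contradiction)
open import Relation.Unary using (Pred; Decidable)

-- `IsSpectrum` asks for an eigenbasis, so the two halves of the infimum are of different depth. In
-- the lower bound the matrix brings an eigenbasis along, and the traces of `A` and of its square
-- are read off from it by conjugation. Attaining the bound requires constructing an eigenbasis of
-- the Laplacian, headed by the all-ones vector with eigenvalue 0. Splitting off eigenvectors one at
-- a time leads to restrictions of `A` to shrinking subspaces, which carry no preferred coordinates.
-- Each subspace is therefore represented by its orthogonal projection `P`, an n by n matrix
-- commuting with `A`, and the restriction of `A - μ` is replaced by `A P - μ P + (1 - P)`, again n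
-- by n and open to elimination. Tests such as `x ≈ 0#` are decided by the trichotomy of the order,
-- which makes pivot search constructive. All estimates rest on sums of squares, so neither square
-- roots nor absolute values occur; for the same reason eigenvectors are never normalised.

module Theory (ℝ : CompleteOrderedField) where
  open CompleteOrderedField ℝ hiding (zero)
  open MinimumVariance ℝ
  open Setoid setoid using (refl; sym; trans; reflexive)
  open import Algebra.Properties.Semiring.Sum semiring
  open import Algebra.Properties.Ring ring
    using (-‿distribˡ-*; -‿distribʳ-*; -0#≈0#; -‿involutive; -‿+-comm)
  import Algebra.Properties.Semiring.Mult semiring as Mult
  import Algebra.Properties.Semiring.Mult.TCOptimised semiring as TC
  open import Relation.Binary.Reasoning.Setoid setoid

  -- Ordered field arithmetic

  module ℤSolver where

    -- With this form of multiple, `con (+ 1)` and `con (+ 2)` reduce to `1#` and `1# + 1#`, so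
    -- solver equations match the goals definitionally; `fromℕ` would leave a trailing `0#`.
    ι : ℕ → Carrier
    ι n = n TC.× 1#

    ⟦_⟧ℤ : ℤ → Carrier
    ⟦ + n ⟧ℤ = ι n
    ⟦ -[1+ n ] ⟧ℤ = - ι (suc n)

    neg-homo : ∀ i → ⟦ ℤ.- i ⟧ℤ ≈ - ⟦ i ⟧ℤ
    neg-homo (+ zero) = sym -0#≈0#
    neg-homo (+ suc n) = refl
    neg-homo -[1+ n ] = sym (-‿involutive _)

    ι-suc : ∀ n → ι (suc n) ≈ 1# + ι n
    ι-suc n = TC.×-homo-+ 1# 1 n

    cancel : ∀ x y → (1# + x) - (1# + y) ≈ x - y
    cancel x y = begin
      (1# + x) - (1# + y)       ≈⟨ +-congˡ (sym (-‿+-comm 1# y)) ⟩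
      (1# + x) + (- 1# - y)     ≈⟨ +-congʳ (+-comm 1# x) ⟩
      (x + 1#) + (- 1# - y)     ≈⟨ +-assoc x 1# _ ⟩
      x + (1# + (- 1# - y))     ≈⟨ +-congˡ (sym (+-assoc 1# _ _)) ⟩
      x + ((1# - 1#) - y)       ≈⟨ +-congˡ (+-congʳ (-‿inverseʳ 1#)) ⟩
      x + (0# - y)              ≈⟨ +-congˡ (+-identityˡ _) ⟩
      x - y                     ∎

    ⊖-homo : ∀ m n → ⟦ m ℤ.⊖ n ⟧ℤ ≈ ι m - ι n
    ⊖-homo m zero = sym (trans (+-congˡ -0#≈0#) (+-identityʳ _))
    ⊖-homo zero (suc n) = sym (+-identityˡ _)
    ⊖-homo (suc m) (suc n) = begin
      ⟦ suc m ℤ.⊖ suc n ⟧ℤ     ≡⟨ ≡.cong ⟦_⟧ℤ (ℤ.[1+m]⊖[1+n]≡m⊖n m n) ⟩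
      ⟦ m ℤ.⊖ n ⟧ℤ             ≈⟨ ⊖-homo m n ⟩
      ι m - ι n                ≈⟨ cancel _ _ ⟨
      (1# + ι m) - (1# + ι n)  ≈⟨ +-cong (ι-suc m) (-‿cong (ι-suc n)) ⟨
      ι (suc m) - ι (suc n)    ∎

    add-homo : ∀ i j → ⟦ i ℤ.+ j ⟧ℤ ≈ ⟦ i ⟧ℤ + ⟦ j ⟧ℤ
    add-homo (+ m) (+ n) = TC.×-homo-+ 1# m n
    add-homo (+ m) -[1+ n ] = ⊖-homo m (suc n)
    add-homo -[1+ m ] (+ n) = trans (⊖-homo n (suc m)) (+-comm _ _)
    add-homo -[1+ m ] -[1+ n ] = begin
      - ι (suc (suc (m ℕ.+ n)))     ≈⟨ -‿cong (reflexive (≡.cong (ι ∘ suc) (≡.sym (ℕ.+-suc m n)))) ⟩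
      - ι (suc m ℕ.+ suc n)         ≈⟨ -‿cong (TC.×-homo-+ 1# (suc m) (suc n)) ⟩
      - (ι (suc m) + ι (suc n))     ≈⟨ -‿+-comm _ _ ⟨
      - ι (suc m) - ι (suc n)       ∎

    mul-homo : ∀ i j → ⟦ i ℤ.* j ⟧ℤ ≈ ⟦ i ⟧ℤ * ⟦ j ⟧ℤ
    mul-homo⁺ : ∀ m j → ⟦ + m ℤ.* j ⟧ℤ ≈ ι m * ⟦ j ⟧ℤ
    mul-homo⁺ m (+ n) = trans (reflexive (≡.cong ⟦_⟧ℤ (≡.sym (ℤ.pos-* m n)))) (TC.×1-homo-* m n)
    mul-homo⁺ m -[1+ n ] = begin
      ⟦ + m ℤ.* (ℤ.- (+ suc n)) ⟧ℤ  ≡⟨ ≡.cong ⟦_⟧ℤ (ℤ.neg-distribʳ-* (+ m) (+ suc n)) ⟨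
      ⟦ ℤ.- (+ m ℤ.* + suc n) ⟧ℤ    ≈⟨ neg-homo (+ m ℤ.* + suc n) ⟩
      - ⟦ + m ℤ.* + suc n ⟧ℤ        ≈⟨ -‿cong (mul-homo⁺ m (+ suc n)) ⟩
      - (ι m * ι (suc n))           ≈⟨ -‿distribʳ-* _ _ ⟩
      ι m * - ι (suc n)             ∎
    mul-homo (+ m) j = mul-homo⁺ m j
    mul-homo -[1+ m ] j = begin
      ⟦ (ℤ.- (+ suc m)) ℤ.* j ⟧ℤ    ≡⟨ ≡.cong ⟦_⟧ℤ (ℤ.neg-distribˡ-* (+ suc m) j) ⟨
      ⟦ ℤ.- (+ suc m ℤ.* j) ⟧ℤ      ≈⟨ neg-homo (+ suc m ℤ.* j) ⟩
      - ⟦ + suc m ℤ.* j ⟧ℤ          ≈⟨ -‿cong (mul-homo⁺ (suc m) j) ⟩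
      - (ι (suc m) * ⟦ j ⟧ℤ)        ≈⟨ -‿distribˡ-* _ _ ⟩
      - ι (suc m) * ⟦ j ⟧ℤ          ∎

    morphism : ℤ.+-*-rawRing -Raw-AlmostCommutative⟶ fromCommutativeRing commutativeRing
    morphism = record
      { ⟦_⟧ = ⟦_⟧ℤ ; +-homo = add-homo ; *-homo = mul-homo ; -‿homo = neg-homo
      ; 0-homo = refl ; 1-homo = refl }

    coeff≟ : WeaklyDecidable (λ i j → ⟦ i ⟧ℤ ≈ ⟦ j ⟧ℤ)
    coeff≟ i j with i ℤ.≟ j
    ... | yes ≡.refl = just refl
    ... | no _ = nothing

    open Algebra.Solver.Ring ℤ.+-*-rawRing (fromCommutativeRing commutativeRing) morphism coeff≟ public
      using (solve; _:=_; _:+_; _:*_; _:-_; :-_; con)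

  open ℤSolver using (solve; _:=_; _:+_; _:*_; _:-_; :-_; con)

  open IsStrictTotalOrder isStrictTotalOrder using (compare; _≟_)
    renaming (trans to <-trans; irrefl to <-irrefl; <-respʳ-≈ to <-respʳ; <-respˡ-≈ to <-respˡ)

  -- Order, squares and inverses

  ≤-refl : ∀ {x} → x ≤ x
  ≤-refl = inj₂ refl

  ≤-respʳ : ∀ {x y z} → y ≈ z → x ≤ y → x ≤ z
  ≤-respʳ e (inj₁ p) = inj₁ (<-respʳ e p)
  ≤-respʳ e (inj₂ p) = inj₂ (trans p e)

  ≤-respˡ : ∀ {x y z} → y ≈ z → y ≤ x → z ≤ x
  ≤-respˡ e (inj₁ p) = inj₁ (<-respˡ e p)
  ≤-respˡ e (inj₂ p) = inj₂ (trans (sym e) p)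

  ≤-trans : ∀ {x y z} → x ≤ y → y ≤ z → x ≤ z
  ≤-trans (inj₁ p) (inj₁ q) = inj₁ (<-trans p q)
  ≤-trans p (inj₂ e) = ≤-respʳ e p
  ≤-trans (inj₂ e) q = ≤-respˡ (sym e) q

  <-≤-trans : ∀ {x y z} → x < y → y ≤ z → x < z
  <-≤-trans p (inj₁ q) = <-trans p q
  <-≤-trans p (inj₂ e) = <-respʳ e p

  <⇒≱ : ∀ {x y} → x < y → ¬ y ≤ x
  <⇒≱ p q = <-irrefl refl (<-≤-trans p q)

  ≰⇒> : ∀ {x y} → ¬ x ≤ y → y < x
  ≰⇒> {x} {y} p with compare x y
  ... | tri< a _ _ = contradiction (inj₁ a) p
  ... | tri≈ _ a _ = contradiction (inj₂ a) p
  ... | tri> _ _ a = a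

  +-monoʳ-≤ : ∀ z {x y} → x ≤ y → z + x ≤ z + y
  +-monoʳ-≤ z (inj₁ p) = inj₁ (+-monoʳ-< z p)
  +-monoʳ-≤ z (inj₂ p) = inj₂ (+-congˡ p)

  +-mono-≤ : ∀ {x y u v} → x ≤ y → u ≤ v → x + u ≤ y + v
  +-mono-≤ {x} {y} {u} {v} p q = ≤-trans (+-monoʳ-≤ x q)
    (≤-respˡ (+-comm v x) (≤-respʳ (+-comm v y) (+-monoʳ-≤ v p)))

  +-nonneg : ∀ {x y} → 0# ≤ x → 0# ≤ y → 0# ≤ x + y
  +-nonneg p q = ≤-respˡ (+-identityˡ 0#) (+-mono-≤ p q)

  +-positive : ∀ {x y} → 0# < x → 0# ≤ y → 0# < x + y
  +-positive {x} p q = <-≤-trans (<-respʳ (sym (+-identityʳ x)) p) (+-monoʳ-≤ x q)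

  x<y⇒0<y-x : ∀ {x y} → x < y → 0# < y - x
  x<y⇒0<y-x {x} {y} p = <-respˡ (-‿inverseˡ x) (<-respʳ (+-comm _ _) (+-monoʳ-< (- x) p))

  x≤y⇒0≤y-x : ∀ {x y} → x ≤ y → 0# ≤ y - x
  x≤y⇒0≤y-x {x} {y} p = ≤-respˡ (-‿inverseˡ x) (≤-respʳ (+-comm _ _) (+-monoʳ-≤ (- x) p))

  0≤y-x⇒x≤y : ∀ {x y} → 0# ≤ y - x → x ≤ y
  0≤y-x⇒x≤y {x} {y} p = ≤-respˡ (+-identityʳ x)
    (≤-respʳ (solve 2 (λ x y → x :+ (y :- x) := y) refl x y) (+-monoʳ-≤ x p))

  x<0⇒0<-x : ∀ {x} → x < 0# → 0# < - x
  x<0⇒0<-x p = <-respʳ (+-identityˡ _) (x<y⇒0<y-x p)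

  *-nonneg : ∀ {x y} → 0# ≤ x → 0# ≤ y → 0# ≤ x * y
  *-nonneg (inj₁ p) (inj₁ q) = inj₁ (*-positive p q)
  *-nonneg (inj₂ p) q = inj₂ (trans (sym (zeroˡ _)) (*-congʳ p))
  *-nonneg (inj₁ p) (inj₂ q) = inj₂ (trans (sym (zeroʳ _)) (*-congˡ q))

  ²-positive : ∀ {x} → ¬ x ≈ 0# → 0# < x ²
  ²-positive {x} x≉0 with compare x 0#
  ... | tri< a _ _ = <-respʳ (solve 1 (λ x → (:- x) :* (:- x) := x :* x) refl x)
                       (*-positive (x<0⇒0<-x a) (x<0⇒0<-x a))
  ... | tri≈ _ a _ = contradiction a x≉0
  ... | tri> _ _ a = *-positive a a

  ²-nonneg : ∀ x → 0# ≤ x ²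
  ²-nonneg x with x ≟ 0#
  ... | yes p = inj₂ (sym (trans (*-congˡ p) (zeroʳ x)))
  ... | no p  = inj₁ (²-positive p)

  0<1 : 0# < 1#
  0<1 = <-respʳ (*-identityˡ 1#) (²-positive (λ e → 0≉1 (sym e)))

  positive⇒≉0 : ∀ {x} → 0# < x → ¬ x ≈ 0#
  positive⇒≉0 p e = <-irrefl (sym e) p

  -- Were `x ⁻¹ ≤ 0#`, then `0 ≤ x * (- x ⁻¹) = - 1`, against `0 < 1`.
  ⁻¹-positive : ∀ {x} → 0# < x → 0# < x ⁻¹
  ⁻¹-positive {x} p = ≰⇒> λ q → <⇒≱ 0<1 $ 0≤y-x⇒x≤y $
    ≤-respʳ (trans (solve 2 (λ x y → x :* (:- y) := con (+ 0) :- x :* y) refl x (x ⁻¹))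
                   (+-congˡ (-‿cong (*-inverseʳ x (positive⇒≉0 p)))))
      (*-nonneg (inj₁ p) (≤-respʳ (+-identityˡ _) (x≤y⇒0≤y-x q)))

  *-cancelˡ-nonneg : ∀ {x y} → 0# < x → 0# ≤ x * y → 0# ≤ y
  *-cancelˡ-nonneg {x} {y} p q = ≤-respʳ
    (trans (solve 3 (λ x y z → z :* (x :* y) := x :* z :* y) refl x y (x ⁻¹))
      (trans (*-congʳ (*-inverseʳ x (positive⇒≉0 p))) (*-identityˡ y)))
    (*-nonneg (inj₁ (⁻¹-positive p)) q)

  *-cancelˡ-zero : ∀ {x y} → ¬ x ≈ 0# → x * y ≈ 0# → y ≈ 0#
  *-cancelˡ-zero {x} {y} p q = begin
    y                 ≈⟨ *-identityˡ y ⟨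
    1# * y            ≈⟨ *-congʳ (*-inverseʳ x p) ⟨
    x * x ⁻¹ * y      ≈⟨ solve 3 (λ x y z → x :* z :* y := z :* (x :* y)) refl x y (x ⁻¹) ⟩
    x ⁻¹ * (x * y)    ≈⟨ *-congˡ q ⟩
    x ⁻¹ * 0#         ≈⟨ zeroʳ _ ⟩
    0#                ∎

  fromℕ-nonneg : ∀ k → 0# ≤ fromℕ k
  fromℕ-nonneg zero = ≤-refl
  fromℕ-nonneg (suc k) = +-nonneg (inj₁ 0<1) (fromℕ-nonneg k)

  fromℕ-positive : ∀ k → 0# < fromℕ (suc k)
  fromℕ-positive k = +-positive 0<1 (fromℕ-nonneg k)

  fromℕ-+ : ∀ k l → fromℕ (k ℕ.+ l) ≈ fromℕ k + fromℕ l
  fromℕ-+ = Mult.×-homo-+ 1#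

  fromℕ-* : ∀ k l → fromℕ (k ℕ.* l) ≈ fromℕ k * fromℕ l
  fromℕ-* = Mult.×1-homo-*

  sum-nonneg : ∀ {n} {f : Vector Carrier n} → (∀ i → 0# ≤ f i) → 0# ≤ sum f
  sum-nonneg {zero} p = ≤-refl
  sum-nonneg {suc n} p = +-nonneg (p zero) (sum-nonneg (p ∘ suc))

  term≤sum : ∀ {n} {f : Vector Carrier n} → (∀ i → 0# ≤ f i) → ∀ i → f i ≤ sum f
  term≤sum {f = f} p zero = ≤-respˡ (+-identityʳ _) (+-monoʳ-≤ (f zero) (sum-nonneg (p ∘ suc)))
  term≤sum {f = f} p (suc i) = ≤-respˡ (+-identityˡ _) (+-mono-≤ (p zero) (term≤sum (p ∘ suc) i))

  sum-mono : ∀ {n} {f g : Vector Carrier n} → (∀ i → f i ≤ g i) → sum f ≤ sum g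
  sum-mono {zero} p = ≤-refl
  sum-mono {suc n} p = +-mono-≤ (p zero) (sum-mono (p ∘ suc))

  -- Finite-dimensional linear algebra

  sum-zero : ∀ {n} {f : Vector Carrier n} → (∀ i → f i ≈ 0#) → sum f ≈ 0#
  sum-zero {n} p = trans (sum-cong-≋ p) (sum-replicate-zero n)

  sum-single : ∀ {n} {f : Vector Carrier n} i → (∀ k → k ≢ i → f k ≈ 0#) → sum f ≈ f i
  sum-single zero p = trans (+-congˡ (sum-zero (λ k → p (suc k) (λ ())))) (+-identityʳ _)
  sum-single (suc i) p = trans (+-cong (p zero (λ ())) (sum-single i (λ k k≢i → p (suc k) (k≢i ∘ Fin.suc-injective)))) (+-identityˡ _)

  1ᴹ-diagonal : ∀ {n} {i j : Fin n} → i ≡ j → 1ᴹ i j ≈ 1#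
  1ᴹ-diagonal {i = i} {j} i≡j with i Fin.≟ j
  ... | yes _ = refl
  ... | no i≢j = contradiction i≡j i≢j

  1ᴹ-offDiagonal : ∀ {n} {i j : Fin n} → i ≢ j → 1ᴹ i j ≈ 0#
  1ᴹ-offDiagonal {i = i} {j} i≢j with i Fin.≟ j
  ... | yes i≡j = contradiction i≡j i≢j
  ... | no _ = refl

  1ᴹ-sym : ∀ {n} (i j : Fin n) → 1ᴹ i j ≈ 1ᴹ j i
  1ᴹ-sym i j with i Fin.≟ j
  ... | yes i≡j = sym (1ᴹ-diagonal (≡.sym i≡j))
  ... | no i≢j = sym (1ᴹ-offDiagonal (i≢j ∘ ≡.sym))

  sum-1ᴹˡ : ∀ {n} (f : Vector Carrier n) i → sum (λ k → 1ᴹ i k * f k) ≈ f i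
  sum-1ᴹˡ f i = trans (sum-single i λ k k≢i → trans (*-congʳ (1ᴹ-offDiagonal (k≢i ∘ ≡.sym))) (zeroˡ _))
                      (trans (*-congʳ (1ᴹ-diagonal {i = i} ≡.refl)) (*-identityˡ _))

  dot : ∀ {n} → Vector Carrier n → Vector Carrier n → Carrier
  dot x y = sum λ i → x i * y i

  infix 4 _≈ⱽ_
  _≈ⱽ_ : ∀ {n} → Vector Carrier n → Vector Carrier n → Set
  x ≈ⱽ y = ∀ i → x i ≈ y i

  dot-cong : ∀ {n} {x x′ y y′ : Vector Carrier n} → x ≈ⱽ x′ → y ≈ⱽ y′ → dot x y ≈ dot x′ y′
  dot-cong p q = sum-cong-≋ λ i → *-cong (p i) (q i)

  dot-congʳ : ∀ {n} (x : Vector Carrier n) {y y′} → y ≈ⱽ y′ → dot x y ≈ dot x y′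
  dot-congʳ x q = dot-cong (λ _ → refl) q

  dot-comm : ∀ {n} (x y : Vector Carrier n) → dot x y ≈ dot y x
  dot-comm x y = sum-cong-≋ λ i → *-comm (x i) (y i)

  dot-linearʳ : ∀ {n} (x y z : Vector Carrier n) s →
                dot x (λ i → y i - s * z i) ≈ dot x y - s * dot x z
  dot-linearʳ {zero} x y z s = solve 1 (λ s → con (+ 0) := con (+ 0) :- s :* con (+ 0)) refl s
  dot-linearʳ {suc n} x y z s = trans (+-congˡ (dot-linearʳ (tail x) (tail y) (tail z) s))
    (solve 6 (λ x y z s a b → x :* (y :- s :* z) :+ (a :- s :* b) := x :* y :+ a :- s :* (x :* z :+ b))
      refl (x zero) (y zero) (z zero) s _ _)

  dot-linearˡ : ∀ {n} (x y z : Vector Carrier n) s →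
                dot (λ i → x i - s * y i) z ≈ dot x z - s * dot y z
  dot-linearˡ x y z s = trans (dot-comm _ z) (trans (dot-linearʳ z x y s)
    (+-cong (dot-comm z x) (-‿cong (*-congˡ (dot-comm z y)))))

  sum-linear : ∀ {n} (f g : Vector Carrier n) s t →
               sum (λ i → s * f i - t * g i) ≈ s * sum f - t * sum g
  sum-linear {zero} f g s t = solve 2 (λ s t → con (+ 0) := s :* con (+ 0) :- t :* con (+ 0)) refl s t
  sum-linear {suc n} f g s t = trans (+-congˡ (sum-linear (tail f) (tail g) s t))
    (solve 6 (λ s t x y a b → s :* x :- t :* y :+ (s :* a :- t :* b) := s :* (x :+ a) :- t :* (y :+ b))
      refl s t (f zero) (g zero) _ _)

  dot-scaleʳ : ∀ {n} (x y : Vector Carrier n) s → dot x (λ i → s * y i) ≈ s * dot x y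
  dot-scaleʳ {n} x y s = trans (sum-cong-≋ {n} λ i → solve 3 (λ x y s → x :* (s :* y) := s :* (x :* y)) refl (x i) (y i) s)
    (sym (*-distribˡ-sum {n} s _))

  NonZero : ∀ {n} → Vector Carrier n → Set
  NonZero x = ∃[ i ] ¬ x i ≈ 0#

  dot-nonneg : ∀ {n} (x : Vector Carrier n) → 0# ≤ dot x x
  dot-nonneg x = sum-nonneg (λ i → ²-nonneg (x i))

  dot-positive : ∀ {n} {x : Vector Carrier n} → NonZero x → 0# < dot x x
  dot-positive {x = x} (i , xi≉0) = <-≤-trans (²-positive xi≉0) (term≤sum (λ i → ²-nonneg (x i)) i)

  dot-zero : ∀ {n} {x : Vector Carrier n} → dot x x ≈ 0# → ∀ i → x i ≈ 0#
  dot-zero {x = x} p i with x i ≟ 0#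
  ... | yes q = q
  ... | no q = contradiction p (positive⇒≉0 (dot-positive (i , q)))

  *ⱽ-cong : ∀ {n} (A : Matrix n) {x y} → x ≈ⱽ y → A *ⱽ x ≈ⱽ A *ⱽ y
  *ⱽ-cong A p i = dot-congʳ (A i) p

  *ⱽ-assoc : ∀ {n} (A B : Matrix n) x → (A *ᴹ B) *ⱽ x ≈ⱽ A *ⱽ (B *ⱽ x)
  *ⱽ-assoc {n} A B x i = begin
    sum (λ k → sum (λ j → A i j * B j k) * x k)    ≈⟨ sum-cong-≋ {n} (λ k → *-distribʳ-sum {n} (x k) _) ⟩
    sum (λ k → sum (λ j → A i j * B j k * x k))    ≈⟨ ∑-comm (λ k j → A i j * B j k * x k) ⟩
    sum (λ j → sum (λ k → A i j * B j k * x k))    ≈⟨ sum-cong-≋ {n} (λ j → trans (sum-cong-≋ {n} (λ k → *-assoc _ _ _)) (sym (*-distribˡ-sum {n} (A i j) _))) ⟩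
    sum (λ j → A i j * sum (λ k → B j k * x k))    ∎

  1ᴹ-identity : ∀ {n} (x : Vector Carrier n) → 1ᴹ *ⱽ x ≈ⱽ x
  1ᴹ-identity = sum-1ᴹˡ

  *ⱽ-column : ∀ {n} (A : Matrix n) j → A *ⱽ (λ k → 1ᴹ k j) ≈ⱽ λ i → A i j
  *ⱽ-column A j i = trans (sum-cong-≋ λ k → trans (*-comm _ _) (*-congʳ (1ᴹ-sym k j))) (sum-1ᴹˡ (A i) j)

  *ⱽ-zero : ∀ {n} (A : Matrix n) {x} → (∀ i → x i ≈ 0#) → ∀ i → (A *ⱽ x) i ≈ 0#
  *ⱽ-zero A p i = sum-zero λ k → trans (*-congˡ (p k)) (zeroʳ _)

  *ᴹ-assoc : ∀ {n} (A B C : Matrix n) i j → ((A *ᴹ B) *ᴹ C) i j ≈ (A *ᴹ (B *ᴹ C)) i j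
  *ᴹ-assoc A B C i j = *ⱽ-assoc A B (λ k → C k j) i

  trace-comm : ∀ {n} (A B : Matrix n) → trace (A *ᴹ B) ≈ trace (B *ᴹ A)
  trace-comm {n} A B = trans (∑-comm (λ i k → A i k * B k i)) (sum-cong-≋ {n} λ k → sum-cong-≋ {n} λ i → *-comm _ _)

  -- Gaussian elimination with more unknowns than equations. If the first column vanishes, the first
  -- unit vector is a solution. Otherwise a row with nonzero first entry eliminates the first
  -- unknown from all other rows; one equation and one unknown fewer remain.
  kernel : ∀ {m n} → m ℕ.< n → (M : Fin m → Vector Carrier n) →
           ∃[ x ] NonZero x × (∀ i → dot (M i) x ≈ 0#)
  kernel {zero} {suc n} _ M = (λ _ → 1#) , (zero , 0≉1 ∘ sym) , λ ()
  kernel {suc m} {suc n} (s≤s m<n) M with Fin.all? (λ i → M i zero ≟ 0#)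
  ... | yes column≈0 = (1# ∷ⱽ λ _ → 0#) , (zero , 0≉1 ∘ sym) , λ i →
    trans (+-cong (trans (*-identityʳ _) (column≈0 i)) (sum-zero {n} λ j → zeroʳ _)) (+-identityˡ _)
  ... | no ¬column≈0 with Fin.¬∀⟶∃¬ _ _ (λ i → M i zero ≟ 0#) ¬column≈0
  ... | p , pivot≉0 = x₀ ∷ⱽ x , (suc (proj₁ x≉0) , proj₂ x≉0) , solves
    where
    pivot⁻¹ : Carrier
    pivot⁻¹ = M p zero ⁻¹

    factor : Fin m → Carrier
    factor i = M (punchIn p i) zero * pivot⁻¹

    reduced : Fin m → Vector Carrier n
    reduced i j = M (punchIn p i) (suc j) - factor i * M p (suc j)

    solution : ∃[ x ] NonZero x × (∀ i → dot (reduced i) x ≈ 0#)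
    solution = kernel m<n reduced

    x : Vector Carrier n
    x = proj₁ solution

    x≉0 : NonZero x
    x≉0 = proj₁ (proj₂ solution)

    -- Back substitution: the value that makes the pivot row vanish.
    x₀ : Carrier
    x₀ = - (pivot⁻¹ * dot (tail (M p)) x)

    solves-punchIn : ∀ i → dot (M (punchIn p i)) (x₀ ∷ⱽ x) ≈ 0#
    solves-punchIn i = begin
      M q zero * x₀ + dot (tail (M q)) x               ≈⟨ solve 4 (λ a b c d → a :* (:- (b :* c)) :+ d := d :- a :* b :* c) refl (M q zero) pivot⁻¹ _ _ ⟩
      dot (tail (M q)) x - factor i * dot (tail (M p)) x  ≈⟨ dot-linearˡ (tail (M q)) (tail (M p)) x (factor i) ⟨
      dot (reduced i) x                                ≈⟨ proj₂ (proj₂ solution) i ⟩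
      0#                                               ∎
      where q = punchIn p i

    solves : ∀ i → dot (M i) (x₀ ∷ⱽ x) ≈ 0#
    solves i with p Fin.≟ i
    ... | no p≢i = ≡.subst (λ q → dot (M q) (x₀ ∷ⱽ x) ≈ 0#) (Fin.punchIn-punchOut p≢i) (solves-punchIn (punchOut p≢i))
    ... | yes ≡.refl = begin
      M p zero * x₀ + s                                ≈⟨ solve 3 (λ a b c → a :* (:- (b :* c)) :+ c := c :- a :* b :* c) refl (M p zero) pivot⁻¹ s ⟩
      s - M p zero * pivot⁻¹ * s                       ≈⟨ +-congˡ (-‿cong (trans (*-congʳ (*-inverseʳ _ pivot≉0)) (*-identityˡ s))) ⟩
      s - s                                            ≈⟨ -‿inverseʳ s ⟩
      0#                                               ∎
      where s = dot (tail (M p)) x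

  Singular : ∀ {n} → Matrix n → Set
  Singular M = ∃[ x ] NonZero x × (∀ i → (M *ⱽ x) i ≈ 0#)

  -- Prefixing `M` with the j-th unit column gives n equations in n + 1 unknowns, which have a
  -- nonzero solution. If its first coordinate is zero, the tail lies in the kernel of `M`;
  -- otherwise the tail divided by minus that coordinate is the required `y`.
  singular-or-column : ∀ {n} (M : Matrix n) j → Singular M ⊎ ∃[ y ] M *ⱽ y ≈ⱽ λ i → 1ᴹ i j
  singular-or-column M j with kernel (ℕ.n<1+n _) (λ i → 1ᴹ i j ∷ⱽ M i)
  ... | x , x≉0 , Mx≈0 with x zero ≟ 0#
  ... | yes x₀≈0 = inj₁ (tail x , nonzero x≉0 , λ i →
          trans (sym (trans (+-congʳ (trans (*-congˡ x₀≈0) (zeroʳ _))) (+-identityˡ _))) (Mx≈0 i))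
    where
    nonzero : NonZero x → NonZero (tail x)
    nonzero (zero , x₀≉0) = contradiction x₀≈0 x₀≉0
    nonzero (suc i , xᵢ≉0) = i , xᵢ≉0
  ... | no x₀≉0 = inj₂ ((λ k → - (x zero ⁻¹) * x (suc k)) , λ i → begin
    dot (M i) (λ k → - (x zero ⁻¹) * x (suc k))        ≈⟨ dot-scaleʳ (M i) (tail x) _ ⟩
    - (x zero ⁻¹) * dot (M i) (tail x)                 ≈⟨ solve 4 (λ u a b d → (:- u) :* d := d′ u a b d) refl (x zero ⁻¹) (x zero) (1ᴹ i j) _ ⟩
    x zero * x zero ⁻¹ * 1ᴹ i j - x zero ⁻¹ * (1ᴹ i j * x zero + dot (M i) (tail x))  ≈⟨ +-cong (trans (*-congʳ (*-inverseʳ _ x₀≉0)) (*-identityˡ _)) (trans (-‿cong (trans (*-congˡ (Mx≈0 i)) (zeroʳ _))) -0#≈0#) ⟩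
    1ᴹ i j + 0#                                        ≈⟨ +-identityʳ _ ⟩
    1ᴹ i j                                             ∎)
    where
    d′ = λ u a b d → a :* u :* b :- u :* (b :* a :+ d)

  singular-or-rightInverse : ∀ {n} (M : Matrix n) →
                             Singular M ⊎ ∃[ N ] (∀ i j → (M *ᴹ N) i j ≈ 1ᴹ i j)
  -- Collects the columns of the inverse; a single singular outcome settles the whole alternative.
  singular-or-rightInverse M with Fin.sequence (applicative (Singular M) 0ℓ) (singular-or-column M)
  ... | inj₁ s = inj₁ s
  ... | inj₂ c = inj₂ ((λ i j → proj₁ (c j) i) , λ i j → proj₂ (c j) i)

  -- A right inverse `N` has no kernel, because `M N = 1`, so it has a right inverse `K` itself.
  -- Then `M = M (N K) = (M N) K = K`, which makes `N` two-sided.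
  singular-or-invertible : ∀ {n} (M : Matrix n) → Singular M ⊎ ∃[ N ] IsInverse M N
  singular-or-invertible M with singular-or-rightInverse M
  ... | inj₁ s = inj₁ s
  ... | inj₂ (N , MN≈1) with singular-or-rightInverse N
  ... | inj₁ (y , (i , yᵢ≉0) , Ny≈0) = contradiction
          (trans (sym (1ᴹ-identity y i)) (trans (sum-cong-≋ λ k → *-congʳ (sym (MN≈1 i k)))
            (trans (*ⱽ-assoc M N y i) (*ⱽ-zero M Ny≈0 i))))
          yᵢ≉0
  ... | inj₂ (K , NK≈1) = inj₂ (N , MN≈1 , λ i j → trans (*ⱽ-cong N (λ k → M≈K k j) i) (NK≈1 i j))
    where
    M≈K : ∀ i j → M i j ≈ K i j
    M≈K i j = begin
      M i j                      ≈⟨ *ⱽ-column M j i ⟨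
      (M *ᴹ 1ᴹ) i j              ≈⟨ *ⱽ-cong M (λ k → NK≈1 k j) i ⟨
      (M *ᴹ (N *ᴹ K)) i j        ≈⟨ *ᴹ-assoc M N K i j ⟨
      ((M *ᴹ N) *ᴹ K) i j        ≈⟨ sum-cong-≋ (λ k → *-congʳ (MN≈1 i k)) ⟩
      (1ᴹ *ᴹ K) i j              ≈⟨ sum-1ᴹˡ (λ k → K k j) i ⟩
      K i j                      ∎

  -- Existence of an eigenvector

  -- Twice the difference of the two sides is a sum of nonnegative terms. The crude constant
  -- `t ² + 1#` takes the place of the absolute value of `t`.
  product-bound : ∀ x t y z → 0# ≤ z - x ² → 0# ≤ z - y ² → x * (t * y) ≤ (t ² + 1#) * z
  product-bound x t y z p q = 0≤y-x⇒x≤y $ *-cancelˡ-nonneg (+-positive 0<1 (inj₁ 0<1)) $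
    ≤-respʳ (solve 4 (λ x t y z →
        con (+ 2) :* (t :* t :* (z :- x :* x)) :+ con (+ 2) :* (z :- y :* y)
          :+ ((t :* x :- y) :* (t :* x :- y) :+ (t :* x) :* (t :* x) :+ y :* y)
        := con (+ 2) :* ((t :* t :+ con (+ 1)) :* z :- x :* (t :* y))) refl x t y z)
      (+-nonneg (+-nonneg (*-nonneg 0≤2 (*-nonneg (²-nonneg t) p)) (*-nonneg 0≤2 q))
        (+-nonneg (+-nonneg (²-nonneg (t * x - y)) (²-nonneg (t * x))) (²-nonneg y)))
    where
    0≤2 : 0# ≤ 1# + 1#
    0≤2 = inj₁ (+-positive 0<1 (inj₁ 0<1))

  -- `product-bound` summed over all entries, with `z` the squared length of `x`. The extra `1#`
  -- keeps the constant positive even for the empty matrix, so that it can be inverted.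
  quadratic-bound : ∀ {n} (M : Matrix n) → ∃[ K ] 0# < K × (∀ x → dot x (M *ⱽ x) ≤ K * dot x x)
  quadratic-bound {n} M = 1# + K , +-positive 0<1 (sum-nonneg λ i → sum-nonneg λ j → 0≤entry i j) , bound
    where
    entry : Fin n → Fin n → Carrier
    entry i j = M i j ² + 1#

    0≤entry : ∀ i j → 0# ≤ entry i j
    0≤entry i j = +-nonneg (²-nonneg _) (inj₁ 0<1)

    K : Carrier
    K = sum λ i → sum (entry i)

    module _ (x : Vector Carrier n) where
      square≤ : ∀ i → 0# ≤ dot x x - x i ²
      square≤ i = x≤y⇒0≤y-x (term≤sum (λ i → ²-nonneg (x i)) i)

      row : ∀ i → x i * (M *ⱽ x) i ≤ sum (entry i) * dot x x
      row i = ≤-respˡ (sym (*-distribˡ-sum {n} (x i) (λ j → M i j * x j)))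
        (≤-respʳ (sym (*-distribʳ-sum {n} (dot x x) (entry i)))
          (sum-mono {n} λ j → product-bound (x i) (M i j) (x j) (dot x x) (square≤ i) (square≤ j)))

      bound : dot x (M *ⱽ x) ≤ (1# + K) * dot x x
      bound = ≤-trans (≤-respʳ (sym (*-distribʳ-sum {n} (dot x x) (λ i → sum (entry i)))) (sum-mono {n} row))
        (≤-respˡ (+-identityˡ _)
          (≤-respʳ (sym (trans (distribʳ _ 1# K) (+-congʳ (*-identityˡ _))))
            (+-mono-≤ (dot-nonneg x) ≤-refl)))

  SelfAdjoint : ∀ {n} → Matrix n → Set
  SelfAdjoint A = ∀ x y → dot x (A *ⱽ y) ≈ dot (A *ⱽ x) y

  symmetric⇒selfAdjoint : ∀ {n} {A : Matrix n} → (∀ i j → A i j ≈ A j i) → SelfAdjoint A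
  symmetric⇒selfAdjoint {n} {A} s x y = begin
    sum (λ i → x i * sum (λ j → A i j * y j))    ≈⟨ sum-cong-≋ {n} (λ i → *-distribˡ-sum {n} (x i) _) ⟩
    sum (λ i → sum (λ j → x i * (A i j * y j)))  ≈⟨ ∑-comm (λ i j → x i * (A i j * y j)) ⟩
    sum (λ j → sum (λ i → x i * (A i j * y j)))  ≈⟨ sum-cong-≋ {n} (λ j → trans (sum-cong-≋ {n} λ i → entry i j) (sym (*-distribʳ-sum {n} (y j) _))) ⟩
    sum (λ j → sum (λ i → A j i * x i) * y j)    ∎
    where
    entry : ∀ i j → x i * (A i j * y j) ≈ A j i * x i * y j
    entry i j = trans (solve 3 (λ x a y → x :* (a :* y) := a :* x :* y) refl (x i) (A i j) (y j))
      (*-congʳ (*-congʳ (s i j)))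

  *ⱽ-linear : ∀ {n} (A : Matrix n) x y s → A *ⱽ (λ i → x i - s * y i) ≈ⱽ λ i → (A *ⱽ x) i - s * (A *ⱽ y) i
  *ⱽ-linear A x y s i = dot-linearʳ (A i) x y s

  -- If ⟨x , B⁻¹x⟩ ≤ K⟨x , x⟩, then nonnegativity of the form of B at x - K⁻¹B⁻¹x
  -- gives ⟨x , Bx⟩ ≥ K⁻¹⟨x , x⟩.
  module Coercivity {n} (B N : Matrix n) (adj : SelfAdjoint B) (psd : ∀ x → 0# ≤ dot x (B *ⱽ x))
                  (BN≈1 : ∀ i j → (B *ᴹ N) i j ≈ 1ᴹ i j)
                  (K : Carrier) (0<K : 0# < K) (bound : ∀ x → dot x (N *ⱽ x) ≤ K * dot x x) where
    s : Carrier
    s = K ⁻¹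

    module _ (x : Vector Carrier n) where
      y z : Vector Carrier n
      y = N *ⱽ x
      z i = x i - s * y i

      By≈x : B *ⱽ y ≈ⱽ x
      By≈x i = trans (sym (*ⱽ-assoc B N x i)) (trans (sum-cong-≋ {n} λ k → *-congʳ (BN≈1 i k)) (1ᴹ-identity x i))

      Bz : B *ⱽ z ≈ⱽ λ i → (B *ⱽ x) i - s * x i
      Bz i = trans (*ⱽ-linear B x y s i) (+-congˡ (-‿cong (*-congˡ (By≈x i))))

      form : dot z (B *ⱽ z) ≈ dot x (B *ⱽ x) - s * dot x x - s * (dot x x - s * dot x y)
      form = begin
        dot z (B *ⱽ z)                                       ≈⟨ dot-congʳ z Bz ⟩
        dot z (λ i → (B *ⱽ x) i - s * x i)                   ≈⟨ dot-linearˡ x y _ s ⟩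
        dot x (λ i → (B *ⱽ x) i - s * x i) - s * dot y (λ i → (B *ⱽ x) i - s * x i)
          ≈⟨ +-cong (dot-linearʳ x _ x s) (-‿cong (*-congˡ (trans (dot-linearʳ y _ x s)
               (+-cong (trans (adj y x) (dot-cong {n} By≈x λ _ → refl)) (-‿cong (*-congˡ (dot-comm y x))))))) ⟩
        dot x (B *ⱽ x) - s * dot x x - s * (dot x x - s * dot x y) ∎

      coercive : 0# ≤ dot x (B *ⱽ x) - s * dot x x
      -- The form at `z` contains `s ² * dot x y`, the quantity limited by `bound`. Adding `s ²`
      -- times the slack of `bound` cancels it, and `K * s = 1` removes the remainder.
      coercive = ≤-respʳ combine (+-nonneg (≤-respʳ form (psd z))
        (*-nonneg (²-nonneg s) (x≤y⇒0≤y-x (bound x))))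
        where
        combine : (dot x (B *ⱽ x) - s * dot x x - s * (dot x x - s * dot x y)) + s ² * (K * dot x x - dot x y)
                  ≈ dot x (B *ⱽ x) - s * dot x x
        combine = trans
          (solve 5 (λ b s q d K → (b :- s :* q :- s :* (q :- s :* d)) :+ s :* s :* (K :* q :- d)
                      := (b :- s :* q) :+ s :* q :* (K :* s :- con (+ 1))) refl _ s (dot x x) (dot x y) K)
          (trans (+-congˡ (trans (*-congˡ (trans (+-congʳ (*-inverseʳ K (positive⇒≉0 0<K))) (-‿inverseʳ 1#))) (zeroʳ _)))
                 (+-identityʳ _))

  Coercive : ∀ {n} → Matrix n → Set
  Coercive B = ∃[ c ] 0# < c × (∀ x → c * dot x x ≤ dot x (B *ⱽ x))

  invertible⇒coercive : ∀ {n} (B : Matrix n) → SelfAdjoint B → (∀ x → 0# ≤ dot x (B *ⱽ x)) →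
                        ∃[ N ] IsInverse B N → Coercive B
  invertible⇒coercive B adj psd (N , BN≈1 , _) =
    K ⁻¹ , ⁻¹-positive 0<K , λ x → 0≤y-x⇒x≤y (Coercivity.coercive B N adj psd BN≈1 K 0<K bound x)
    where
    K = proj₁ (quadratic-bound N)
    0<K = proj₁ (proj₂ (quadratic-bound N))
    bound = proj₂ (proj₂ (quadratic-bound N))

  -- An orthogonal projection whose range and kernel are both invariant under `A`; it stands for the
  -- subspace in which eigenvectors are still to be found.
  record ReducingProjection {n} (A P : Matrix n) : Set where
    field
      selfAdjoint : SelfAdjoint P
      idempotent  : ∀ x → P *ⱽ (P *ⱽ x) ≈ⱽ P *ⱽ x
      commutes    : ∀ x → A *ⱽ (P *ⱽ x) ≈ⱽ P *ⱽ (A *ⱽ x)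

  Eigenvector : ∀ {n} → Matrix n → Carrier → Vector Carrier n → Set
  Eigenvector A μ v = ∀ i → (A *ⱽ v) i ≈ μ * v i

  ≤-divide : ∀ {t q a} → 0# < q → t * q ≤ a → t ≤ a / q
  ≤-divide {t} {q} {a} 0<q p = 0≤y-x⇒x≤y $ ≤-respʳ
    (trans (solve 4 (λ t q a r → r :* (a :- t :* q) := a :* r :- t :* (q :* r)) refl t q a (q ⁻¹))
      (+-congˡ (-‿cong (trans (*-congˡ (*-inverseʳ q (positive⇒≉0 0<q))) (*-identityʳ t)))))
    (*-nonneg (inj₁ (⁻¹-positive 0<q)) (x≤y⇒0≤y-x p))

  ≤-multiply : ∀ {t q a} → 0# < q → t ≤ a / q → t * q ≤ a
  ≤-multiply {t} {q} {a} 0<q p = 0≤y-x⇒x≤y $ ≤-respʳ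
    (trans (solve 4 (λ t q a r → q :* (a :* r :- t) := a :* (q :* r) :- t :* q) refl t q a (q ⁻¹))
      (+-congʳ (trans (*-congˡ (*-inverseʳ q (positive⇒≉0 0<q))) (*-identityʳ a))))
    (*-nonneg (inj₁ 0<q) (x≤y⇒0≤y-x p))

  module _ {n} {A P : Matrix n} (A-adj : SelfAdjoint A) (proj : ReducingProjection A P) where
    open ReducingProjection proj

    Fixed : Vector Carrier n → Set
    Fixed y = P *ⱽ y ≈ⱽ y

    -- The Rayleigh quotient inequality multiplied out, so that the zero vector needs no exception.
    RayleighBound : Carrier → Set
    RayleighBound t = ∀ y → Fixed y → t * dot y y ≤ dot y (A *ⱽ y)

    rayleighBound-exists : ∃[ t ] RayleighBound t
    rayleighBound-exists = - K , λ y _ → 0≤y-x⇒x≤y $ ≤-respʳ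
      (trans (+-congˡ (-‿cong (negate y))) (solve 3 (λ K q a → K :* q :- :- a := a :- :- K :* q) refl K (dot y y) _))
      (x≤y⇒0≤y-x (proj₂ (proj₂ (quadratic-bound -A)) y))
      where
      -A : Matrix n
      -A i j = - A i j
      K = proj₁ (quadratic-bound -A)
      negate : ∀ y → dot y (-A *ⱽ y) ≈ - dot y (A *ⱽ y)
      negate y = begin
        dot y (λ i → sum λ j → - A i j * y j)        ≈⟨ dot-congʳ y (λ i → trans (sum-cong-≋ {n} λ j →
                                                          solve 2 (λ a y → (:- a) :* y := (:- con (+ 1)) :* (a :* y)) refl (A i j) (y j))
                                                          (sym (*-distribˡ-sum {n} (- 1#) _))) ⟩
        dot y (λ i → - 1# * (A *ⱽ y) i)              ≈⟨ dot-scaleʳ y (A *ⱽ y) _ ⟩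
        - 1# * dot y (A *ⱽ y)                        ≈⟨ solve 1 (λ a → (:- con (+ 1)) :* a := :- a) refl _ ⟩
        - dot y (A *ⱽ y)                             ∎

    eigenvector-exists : (∃[ x ] NonZero (P *ⱽ x)) →
      ∃[ μ ] ∃[ v ] NonZero v × Fixed v × Eigenvector A μ v
    eigenvector-exists (x₀ , Px₀≉0) = μ , [ singular , noncoercive ∘ invertible⇒coercive B B-adj B-psd ]′ (singular-or-invertible B)
      where
      y₀ = P *ⱽ x₀

      -- The Rayleigh quotient of `y₀`, a nonzero vector in the range of `P`, bounds the set from
      -- above.
      μ-sup : ∃[ s ] IsSupremum RayleighBound s
      μ-sup = complete RayleighBound rayleighBound-exists
        (dot y₀ (A *ⱽ y₀) / dot y₀ y₀ , λ t bound → ≤-divide (dot-positive Px₀≉0) (bound y₀ (idempotent x₀)))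

      μ : Carrier
      μ = proj₁ μ-sup

      -- The supremum belongs to the set: the Rayleigh quotient of each nonzero fixed `y` is an
      -- upper bound of it, hence at least the least one.
      μ-bound : RayleighBound μ
      μ-bound y fixed = cases (Fin.all? (λ i → y i ≟ 0#))
        where
        cases : Dec (∀ i → y i ≈ 0#) → μ * dot y y ≤ dot y (A *ⱽ y)
        cases (yes y≈0) = inj₂ (trans (trans (*-congˡ (sum-zero {n} λ i → trans (*-congʳ (y≈0 i)) (zeroˡ _))) (zeroʳ _))
                              (sym (sum-zero {n} λ i → trans (*-congʳ (y≈0 i)) (zeroˡ _))))
        cases (no y≉0) = ≤-multiply 0<yy (proj₂ (proj₂ μ-sup) _ λ t bound → ≤-divide 0<yy (bound y fixed))
          where
          0<yy : 0# < dot y y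
          0<yy = dot-positive (Fin.¬∀⟶∃¬ _ _ (λ i → y i ≟ 0#) y≉0)

      -- The summand `1 - P` leaves no kernel outside the range of `P`, so the dichotomy for this
      -- full-size matrix decides whether `A - μ` is singular on that range.
      B : Matrix n
      B i j = (A *ᴹ P) i j - μ * P i j + (1ᴹ i j - P i j)

      B-apply : ∀ x → B *ⱽ x ≈ⱽ λ i → (A *ⱽ (P *ⱽ x)) i - μ * (P *ⱽ x) i + (x i - (P *ⱽ x) i)
      B-apply x i = begin
        dot (B i) x
          ≈⟨ trans (sum-cong-≋ {n} λ j → distribʳ (x j) _ _) (∑-distrib-+ {n} (λ j → ((A *ᴹ P) i j - μ * P i j) * x j) (λ j → (1ᴹ i j - P i j) * x j)) ⟩
        dot (λ j → (A *ᴹ P) i j - μ * P i j) x + dot (λ j → 1ᴹ i j - P i j) x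
          ≈⟨ +-cong (dot-linearˡ ((A *ᴹ P) i) (P i) x μ)
               (trans (dot-cong {n} {y = x} (λ j → +-congˡ (-‿cong (sym (*-identityˡ _)))) (λ _ → refl)) (dot-linearˡ (1ᴹ i) (P i) x 1#)) ⟩
        dot ((A *ᴹ P) i) x - μ * (P *ⱽ x) i + ((1ᴹ *ⱽ x) i - 1# * (P *ⱽ x) i)
          ≈⟨ +-cong (+-congʳ (*ⱽ-assoc A P x i)) (+-cong (1ᴹ-identity x i) (-‿cong (*-identityˡ _))) ⟩
        (A *ⱽ (P *ⱽ x)) i - μ * (P *ⱽ x) i + (x i - (P *ⱽ x) i) ∎

      B-dot : ∀ x y → dot x (B *ⱽ y) ≈ dot x (A *ⱽ (P *ⱽ y)) - μ * dot x (P *ⱽ y) + (dot x y - dot x (P *ⱽ y))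
      B-dot x y = begin
        dot x (B *ⱽ y)
          ≈⟨ dot-congʳ x (B-apply y) ⟩
        dot x (λ i → (A *ⱽ (P *ⱽ y)) i - μ * (P *ⱽ y) i + (y i - (P *ⱽ y) i))
          -- `dot-linearʳ` handles differences `y - s * z`; the expression is regrouped into two of
          -- them, whence the factors `- 1#` and `μ + 1#`.
          ≈⟨ dot-congʳ x (λ i → solve 4 (λ a μ p y → a :- μ :* p :+ (y :- p) := (a :- (:- con (+ 1)) :* y) :- (μ :+ con (+ 1)) :* p) refl _ μ _ (y i)) ⟩
        dot x (λ i → ((A *ⱽ (P *ⱽ y)) i - - 1# * y i) - (μ + 1#) * (P *ⱽ y) i)
          ≈⟨ trans (dot-linearʳ x _ (P *ⱽ y) _) (+-congʳ (dot-linearʳ x _ y _)) ⟩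
        (dot x (A *ⱽ (P *ⱽ y)) - - 1# * dot x y) - (μ + 1#) * dot x (P *ⱽ y)
          ≈⟨ solve 4 (λ a μ p y → (a :- (:- con (+ 1)) :* y) :- (μ :+ con (+ 1)) :* p := a :- μ :* p :+ (y :- p)) refl _ μ _ (dot x y) ⟩
        dot x (A *ⱽ (P *ⱽ y)) - μ * dot x (P *ⱽ y) + (dot x y - dot x (P *ⱽ y)) ∎

      B-adj : SelfAdjoint B
      B-adj x y = begin
        dot x (B *ⱽ y)   ≈⟨ B-dot x y ⟩
        dot x (A *ⱽ (P *ⱽ y)) - μ * dot x (P *ⱽ y) + (dot x y - dot x (P *ⱽ y))
          ≈⟨ +-cong (+-cong AP-adj (-‿cong (*-congˡ P-adj))) (+-cong (dot-comm x y) (-‿cong P-adj)) ⟩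
        dot y (A *ⱽ (P *ⱽ x)) - μ * dot y (P *ⱽ x) + (dot y x - dot y (P *ⱽ x)) ≈⟨ B-dot y x ⟨
        dot y (B *ⱽ x)   ≈⟨ dot-comm y _ ⟩
        dot (B *ⱽ x) y   ∎
        where
        P-adj : dot x (P *ⱽ y) ≈ dot y (P *ⱽ x)
        P-adj = trans (selfAdjoint x y) (dot-comm _ y)
        AP-adj : dot x (A *ⱽ (P *ⱽ y)) ≈ dot y (A *ⱽ (P *ⱽ x))
        AP-adj = trans (A-adj x _) (trans (selfAdjoint _ y) (trans (dot-comm _ y) (dot-congʳ y (λ i → sym (commutes x i)))))

      -- On the range of P the form of B is that of A - μ, on the kernel of P it is that of the identity.
      B-form : ∀ x → dot x (B *ⱽ x) ≈ (dot (P *ⱽ x) (A *ⱽ (P *ⱽ x)) - μ * dot (P *ⱽ x) (P *ⱽ x))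
                                      + dot (λ i → x i - 1# * (P *ⱽ x) i) (λ i → x i - 1# * (P *ⱽ x) i)
      B-form x = begin
        dot x (B *ⱽ x)  ≈⟨ B-dot x x ⟩
        dot x (A *ⱽ Px) - μ * dot x Px + (dot x x - dot x Px)
          ≈⟨ +-cong (+-cong range (-‿cong (*-congˡ xPx))) rest ⟩
        (dot Px (A *ⱽ Px) - μ * dot Px Px) + dot (λ i → x i - 1# * Px i) (λ i → x i - 1# * Px i) ∎
        where
        Px = P *ⱽ x
        range : dot x (A *ⱽ Px) ≈ dot Px (A *ⱽ Px)
        range = trans (dot-congʳ x λ i → trans (*ⱽ-cong A (λ j → sym (idempotent x j)) i) (commutes Px i)) (selfAdjoint x _)
        xPx : dot x Px ≈ dot Px Px
        xPx = trans (dot-congʳ x λ i → sym (idempotent x i)) (selfAdjoint x Px)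
        rest : dot x x - dot x Px ≈ dot (λ i → x i - 1# * Px i) (λ i → x i - 1# * Px i)
        rest = sym (begin
          dot (λ i → x i - 1# * Px i) (λ i → x i - 1# * Px i)
            ≈⟨ trans (dot-linearˡ x Px _ 1#) (+-cong (dot-linearʳ x x Px 1#) (-‿cong (*-congˡ (dot-linearʳ Px x Px 1#)))) ⟩
          dot x x - 1# * dot x Px - 1# * (dot Px x - 1# * dot Px Px)
            ≈⟨ +-congˡ (-‿cong (*-congˡ (+-cong (dot-comm Px x) (-‿cong (*-congˡ (sym xPx)))))) ⟩
          dot x x - 1# * dot x Px - 1# * (dot x Px - 1# * dot x Px)
            ≈⟨ solve 2 (λ a b → a :- con (+ 1) :* b :- con (+ 1) :* (b :- con (+ 1) :* b) := a :- b) refl (dot x x) (dot x Px) ⟩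
          dot x x - dot x Px ∎)

      B-psd : ∀ x → 0# ≤ dot x (B *ⱽ x)
      B-psd x = ≤-respʳ (sym (B-form x)) (+-nonneg (x≤y⇒0≤y-x (μ-bound _ (idempotent x))) (dot-nonneg (λ i → x i - 1# * (P *ⱽ x) i)))

      singular : Singular B → ∃[ v ] NonZero v × Fixed v × Eigenvector A μ v
      singular (v , v≉0 , Bv≈0) = v , v≉0 , fixed , eigenvector
        where
        w : Vector Carrier n
        w i = v i - 1# * (P *ⱽ v) i

        -- By `B-form` the vanishing number `dot v (B *ⱽ v)` is the sum of two nonnegative terms, of
        -- which `dot w w` is one.
        ww≈0 : dot w w ≈ 0#
        ww≈0 = [ (λ 0<ww → contradiction
          (trans (sym (B-form v)) (sum-zero {n} λ i → trans (*-congˡ (Bv≈0 i)) (zeroʳ _)))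
          (positive⇒≉0 (<-respʳ (+-comm _ _) (+-positive 0<ww (x≤y⇒0≤y-x (μ-bound _ (idempotent v)))))))
          , sym ]′ (dot-nonneg w)

        fixed : Fixed v
        fixed i = begin
          (P *ⱽ v) i                        ≈⟨ solve 2 (λ p v → p := v :- (v :- con (+ 1) :* p)) refl _ (v i) ⟩
          v i - w i                         ≈⟨ +-congˡ (trans (-‿cong (dot-zero {x = w} ww≈0 i)) -0#≈0#) ⟩
          v i + 0#                          ≈⟨ +-identityʳ _ ⟩
          v i                               ∎

        eigenvector : Eigenvector A μ v
        eigenvector i = begin
          (A *ⱽ v) i            ≈⟨ solve 3 (λ a μ v → a := (a :- μ :* v :+ (v :- v)) :+ μ :* v) refl _ μ (v i) ⟩
          ((A *ⱽ v) i - μ * v i + (v i - v i)) + μ * v i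
            ≈⟨ +-congʳ (trans (sym (trans (B-apply v i) (+-cong (+-cong (*ⱽ-cong A fixed i) (-‿cong (*-congˡ (fixed i)))) (+-congˡ (-‿cong (fixed i)))))) (Bv≈0 i)) ⟩
          0# + μ * v i          ≈⟨ +-identityˡ _ ⟩
          μ * v i               ∎
      noncoercive : ∀ {W : Set} → Coercive B → W
      noncoercive (c , 0<c , coercive) = contradiction (proj₁ (proj₂ μ-sup) (μ + c) larger) (<⇒≱ μ<μ+c)
        where
        μ<μ+c : μ < μ + c
        μ<μ+c = <-respˡ (+-identityʳ μ) (+-monoʳ-< μ 0<c)

        larger : RayleighBound (μ + c)
        larger y fixed = 0≤y-x⇒x≤y (≤-respʳ (begin
          dot y (B *ⱽ y) - c * dot y y
            ≈⟨ +-congʳ (trans (B-dot y y) (+-cong (+-cong (dot-congʳ y (*ⱽ-cong A fixed)) (-‿cong (*-congˡ (dot-congʳ y fixed)))) (+-congˡ (-‿cong (dot-congʳ y fixed))))) ⟩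
          (dot y (A *ⱽ y) - μ * dot y y + (dot y y - dot y y)) - c * dot y y
            ≈⟨ solve 4 (λ a μ q c → (a :- μ :* q :+ (q :- q)) :- c :* q := a :- (μ :+ c) :* q) refl _ μ (dot y y) c ⟩
          dot y (A *ⱽ y) - (μ + c) * dot y y ∎) (x≤y⇒0≤y-x (coercive y)))

  -- The spectral theorem

  module Deflation {n} {A P : Matrix n} (A-adj : SelfAdjoint A) (proj : ReducingProjection A P)
                   {v : Vector Carrier n} {μ : Carrier} (v≉0 : NonZero v)
                   (Pv≈v : P *ⱽ v ≈ⱽ v) (Av≈μv : Eigenvector A μ v) where
    open ReducingProjection proj

    q : Carrier
    q = dot v v

    q*q⁻¹≈1 : q * q ⁻¹ ≈ 1#
    q*q⁻¹≈1 = *-inverseʳ q (positive⇒≉0 (dot-positive v≉0))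

    -- `P` minus the orthogonal projection onto the line of `v`; dividing by `q` replaces
    -- normalising `v`.
    deflated : Matrix n
    deflated i j = P i j - v i * q ⁻¹ * v j

    coefficient : Vector Carrier n → Carrier
    coefficient x = dot v x * q ⁻¹

    deflated-apply : ∀ x → deflated *ⱽ x ≈ⱽ λ i → (P *ⱽ x) i - coefficient x * v i
    deflated-apply x i = trans (dot-linearˡ (P i) v x (v i * q ⁻¹))
      (+-congˡ (-‿cong (solve 3 (λ v r d → v :* r :* d := d :* r :* v) refl (v i) (q ⁻¹) (dot v x))))

    dot-deflated : ∀ x → dot v (deflated *ⱽ x) ≈ 0#
    dot-deflated x = begin
      dot v (deflated *ⱽ x)                             ≈⟨ dot-congʳ v (deflated-apply x) ⟩
      dot v (λ i → (P *ⱽ x) i - coefficient x * v i)    ≈⟨ dot-linearʳ v (P *ⱽ x) v _ ⟩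
      dot v (P *ⱽ x) - coefficient x * q                ≈⟨ +-cong (trans (selfAdjoint v x) (dot-cong {n} Pv≈v λ _ → refl))
                                                            (-‿cong (trans (solve 3 (λ d r q → d :* r :* q := d :* (q :* r)) refl (dot v x) (q ⁻¹) q)
                                                              (trans (*-congˡ q*q⁻¹≈1) (*-identityʳ _)))) ⟩
      dot v x - dot v x                                 ≈⟨ -‿inverseʳ _ ⟩
      0#                                                ∎

    -- The new range lies inside the old one. Together with `dot-deflated` this gives idempotence:
    -- on a vector fixed by `P` and orthogonal to `v`, deflation changes nothing.
    P-deflated : ∀ x → P *ⱽ (deflated *ⱽ x) ≈ⱽ deflated *ⱽ x
    P-deflated x i = begin
      (P *ⱽ (deflated *ⱽ x)) i                              ≈⟨ *ⱽ-cong P (deflated-apply x) i ⟩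
      (P *ⱽ (λ i → (P *ⱽ x) i - coefficient x * v i)) i     ≈⟨ *ⱽ-linear P (P *ⱽ x) v (coefficient x) i ⟩
      (P *ⱽ (P *ⱽ x)) i - coefficient x * (P *ⱽ v) i        ≈⟨ +-cong (idempotent x i) (-‿cong (*-congˡ (Pv≈v i))) ⟩
      (P *ⱽ x) i - coefficient x * v i                      ≈⟨ deflated-apply x i ⟨
      (deflated *ⱽ x) i                                     ∎

    deflated-fixed : ∀ w → deflated *ⱽ w ≈ⱽ w → P *ⱽ w ≈ⱽ w
    deflated-fixed w fixed i = trans (*ⱽ-cong P (λ j → sym (fixed j)) i) (trans (P-deflated w i) (fixed i))

    deflated-orthogonal : ∀ w → deflated *ⱽ w ≈ⱽ w → dot v w ≈ 0#
    deflated-orthogonal w fixed = trans (dot-congʳ v (λ j → sym (fixed j))) (dot-deflated w)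

    reducing : ReducingProjection A deflated
    reducing = record
      { selfAdjoint = λ x y → begin
          dot x (deflated *ⱽ y)                             ≈⟨ trans (dot-congʳ x (deflated-apply y)) (dot-linearʳ x (P *ⱽ y) v _) ⟩
          dot x (P *ⱽ y) - coefficient y * dot x v          ≈⟨ +-cong (selfAdjoint x y) (-‿cong (trans (*-congˡ (dot-comm x v))
                                                                (solve 3 (λ a b r → a :* r :* b := b :* r :* a) refl (dot v y) (dot v x) (q ⁻¹)))) ⟩
          dot (P *ⱽ x) y - coefficient x * dot v y          ≈⟨ trans (dot-cong {n} (deflated-apply x) (λ _ → refl)) (dot-linearˡ (P *ⱽ x) v y _) ⟨
          dot (deflated *ⱽ x) y                             ∎
      ; idempotent = λ x i → begin
          (deflated *ⱽ (deflated *ⱽ x)) i                   ≈⟨ deflated-apply (deflated *ⱽ x) i ⟩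
          (P *ⱽ (deflated *ⱽ x)) i - coefficient (deflated *ⱽ x) * v i
            ≈⟨ +-cong (P-deflated x i) (-‿cong (trans (*-congʳ (trans (*-congʳ (dot-deflated x)) (zeroˡ _))) (zeroˡ _))) ⟩
          (deflated *ⱽ x) i - 0#                            ≈⟨ trans (+-congˡ -0#≈0#) (+-identityʳ _) ⟩
          (deflated *ⱽ x) i                                 ∎
      ; commutes = λ x i → begin
          (A *ⱽ (deflated *ⱽ x)) i                          ≈⟨ *ⱽ-cong A (deflated-apply x) i ⟩
          (A *ⱽ (λ i → (P *ⱽ x) i - coefficient x * v i)) i ≈⟨ *ⱽ-linear A (P *ⱽ x) v (coefficient x) i ⟩
          (A *ⱽ (P *ⱽ x)) i - coefficient x * (A *ⱽ v) i    ≈⟨ +-cong (commutes x i) (-‿cong (coefficient-A x i)) ⟩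
          (P *ⱽ (A *ⱽ x)) i - coefficient (A *ⱽ x) * v i    ≈⟨ deflated-apply (A *ⱽ x) i ⟨
          (deflated *ⱽ (A *ⱽ x)) i                          ∎
      }
      where
      coefficient-A : ∀ x i → coefficient x * (A *ⱽ v) i ≈ coefficient (A *ⱽ x) * v i
      -- Self-adjointness moves `A` across: `μ ⟨v , x⟩ = ⟨A v , x⟩ = ⟨v , A x⟩`.
      coefficient-A x i = begin
        coefficient x * (A *ⱽ v) i          ≈⟨ *-congˡ (Av≈μv i) ⟩
        dot v x * q ⁻¹ * (μ * v i)          ≈⟨ solve 4 (λ d r μ v → d :* r :* (μ :* v) := μ :* d :* r :* v) refl (dot v x) (q ⁻¹) μ (v i) ⟩
        μ * dot v x * q ⁻¹ * v i            ≈⟨ *-congʳ (*-congʳ (begin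
          μ * dot v x                         ≈⟨ *-congˡ (dot-comm v x) ⟩
          μ * dot x v                         ≈⟨ dot-scaleʳ x v μ ⟨
          dot x (λ j → μ * v j)               ≈⟨ dot-congʳ x Av≈μv ⟨
          dot x (A *ⱽ v)                      ≈⟨ A-adj x v ⟩
          dot (A *ⱽ x) v                      ≈⟨ dot-comm _ v ⟩
          dot v (A *ⱽ x)                      ∎)) ⟩
        dot v (A *ⱽ x) * q ⁻¹ * v i         ∎

    deflated-trace : trace deflated ≈ trace P - 1#
    deflated-trace = begin
      sum (λ i → P i i - v i * q ⁻¹ * v i)         ≈⟨ sum-cong-≋ {n} (λ i → solve 3 (λ p v r → p :- v :* r :* v := con (+ 1) :* p :- r :* (v :* v)) refl (P i i) (v i) (q ⁻¹)) ⟩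
      sum (λ i → 1# * P i i - q ⁻¹ * (v i * v i))  ≈⟨ sum-linear (λ i → P i i) (λ i → v i * v i) 1# (q ⁻¹) ⟩
      1# * trace P - q ⁻¹ * q                      ≈⟨ +-cong (*-identityˡ _) (-‿cong (trans (*-comm _ _) q*q⁻¹≈1)) ⟩
      trace P - 1#                                 ∎

  -- `fixed` drives the induction: a vector fixed by the deflated projection is orthogonal to the
  -- vector split off and still fixed by the earlier projection.
  record EigenFamily {n k} (A P : Matrix n) (eig : Vector Carrier k) : Set where
    field
      vector      : Fin k → Vector Carrier n
      nonZero     : ∀ j → NonZero (vector j)
      fixed       : ∀ j → P *ⱽ vector j ≈ⱽ vector j
      eigenvector : ∀ j → Eigenvector A (eig j) (vector j)
      orthogonal  : ∀ {j l} → j ≢ l → dot (vector j) (vector l) ≈ 0#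

  -- Some diagonal entry is nonzero, and `P i i` is the i-th coordinate of `P` applied to the i-th
  -- unit vector.
  trace≉0⇒nonZero : ∀ {n} (P : Matrix n) → ¬ trace P ≈ 0# → ∃[ x ] NonZero (P *ⱽ x)
  trace≉0⇒nonZero P trace≉0 = (λ k → 1ᴹ k i) , i , λ Pi≈0 → proj₂ entry (trans (sym (*ⱽ-column P i i)) Pi≈0)
    where
    entry : ∃[ i ] ¬ P i i ≈ 0#
    entry = Fin.¬∀⟶∃¬ _ _ (λ i → P i i ≟ 0#) (trace≉0 ∘ sum-zero)
    i = proj₁ entry

  module _ {n} {A : Matrix n} (A-adj : SelfAdjoint A) where

    module _ {P : Matrix n} (proj : ReducingProjection A P) {v : Vector Carrier n} {μ : Carrier}
             (v≉0 : NonZero v) (Pv≈v : P *ⱽ v ≈ⱽ v) (Av≈μv : Eigenvector A μ v) where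
      open Deflation A-adj proj v≉0 Pv≈v Av≈μv

      consFamily : ∀ {k} {eig : Vector Carrier k} → EigenFamily A deflated eig → EigenFamily A P (μ ∷ⱽ eig)
      consFamily {k} {eig} family = record
        { vector = v ∷ⱽ vector ; nonZero = nonZero′ ; fixed = fixed′
        ; eigenvector = eigenvector′ ; orthogonal = λ {j} {l} → orthogonal′ j l }
        where
        open EigenFamily family

        nonZero′ : ∀ j → NonZero ((v ∷ⱽ vector) j)
        nonZero′ zero = v≉0
        nonZero′ (suc j) = nonZero j

        fixed′ : ∀ j → P *ⱽ (v ∷ⱽ vector) j ≈ⱽ (v ∷ⱽ vector) j
        fixed′ zero = Pv≈v
        fixed′ (suc j) = deflated-fixed (vector j) (fixed j)

        eigenvector′ : ∀ j → Eigenvector A ((μ ∷ⱽ eig) j) ((v ∷ⱽ vector) j)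
        eigenvector′ zero = Av≈μv
        eigenvector′ (suc j) = eigenvector j

        orthogonal′ : ∀ j l → j ≢ l → dot ((v ∷ⱽ vector) j) ((v ∷ⱽ vector) l) ≈ 0#
        orthogonal′ zero zero j≢l = contradiction ≡.refl j≢l
        orthogonal′ zero (suc l) _ = deflated-orthogonal (vector l) (fixed l)
        orthogonal′ (suc j) zero _ = trans (dot-comm (vector j) v) (deflated-orthogonal (vector j) (fixed j))
        orthogonal′ (suc j) (suc l) j≢l = orthogonal (j≢l ∘ ≡.cong suc)

    -- The trace of P counts the eigenvectors not yet split off.
    eigenFamily : ∀ k {P : Matrix n} → ReducingProjection A P → trace P ≈ fromℕ k →
                  ∃[ eig ] EigenFamily {k = k} A P eig
    eigenFamily zero _ _ = (λ ()) , record
      { vector = λ () ; nonZero = λ () ; fixed = λ () ; eigenvector = λ () ; orthogonal = λ { {()} } }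
    eigenFamily (suc k) {P} proj trace≈ = extend (eigenvector-exists A-adj proj (trace≉0⇒nonZero P
        (positive⇒≉0 (<-respʳ (sym trace≈) (fromℕ-positive k)))))
      where
      extend : (∃[ μ ] ∃[ v ] NonZero v × P *ⱽ v ≈ⱽ v × Eigenvector A μ v) → ∃[ eig ] EigenFamily {k = suc k} A P eig
      extend (μ , v , v≉0 , Pv≈v , Av≈μv) = μ ∷ⱽ proj₁ rest , consFamily proj v≉0 Pv≈v Av≈μv (proj₂ rest)
        where
        open Deflation A-adj proj v≉0 Pv≈v Av≈μv
        rest : ∃[ eig ] EigenFamily A deflated eig
        rest = eigenFamily k reducing (trans deflated-trace (trans (+-congʳ trace≈)
          (solve 1 (λ x → con (+ 1) :+ x :- con (+ 1) := x) refl (fromℕ k))))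

  -- Eigenbases and traces

  independent⇒invertible : ∀ {n} {v : Fin n → Vector Carrier n} →
    (∀ c → (∀ i → combination c v i ≈ 0#) → ∀ j → c j ≈ 0#) → ∃[ W ] IsInverse (λ i j → v j i) W
  independent⇒invertible {n} {v} independent =
    [ (λ (c , (j , cⱼ≉0) , Vc≈0) → contradiction (independent c (λ i → trans (sum-cong-≋ {n} λ j → *-comm (c j) (v j i)) (Vc≈0 i)) j) cⱼ≉0)
    , (λ w → w) ]′ (singular-or-invertible (λ i j → v j i))

  module _ {n} {v : Fin n → Vector Carrier n} (nonZero : ∀ j → NonZero (v j))
           (orthogonal : ∀ {j l} → j ≢ l → dot (v j) (v l) ≈ 0#) where

    dot-combination : ∀ c l → dot (v l) (combination c v) ≈ c l * dot (v l) (v l)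
    dot-combination c l = begin
      sum (λ i → v l i * sum (λ j → c j * v j i))    ≈⟨ sum-cong-≋ {n} (λ i → *-distribˡ-sum {n} (v l i) _) ⟩
      sum (λ i → sum (λ j → v l i * (c j * v j i)))  ≈⟨ ∑-comm (λ i j → v l i * (c j * v j i)) ⟩
      sum (λ j → dot (v l) (λ i → c j * v j i))      ≈⟨ sum-cong-≋ {n} (λ j → dot-scaleʳ (v l) (v j) (c j)) ⟩
      sum (λ j → c j * dot (v l) (v j))              ≈⟨ sum-single {n} l (λ j j≢l → trans (*-congˡ (orthogonal (j≢l ∘ ≡.sym))) (zeroʳ _)) ⟩
      c l * dot (v l) (v l)                          ∎

    independent : ∀ c → (∀ i → combination c v i ≈ 0#) → ∀ j → c j ≈ 0#
    independent c p j = *-cancelˡ-zero (positive⇒≉0 (dot-positive (nonZero j)))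
      (trans (*-comm _ _) (trans (sym (dot-combination c j)) (sum-zero {n} λ i → trans (*-congˡ (p i)) (zeroʳ _))))

    orthogonal⇒basis : IsBasis v
    orthogonal⇒basis = independent , λ x → W *ⱽ x , λ i → begin
      combination (W *ⱽ x) v i     ≈⟨ sum-cong-≋ {n} (λ j → *-comm _ _) ⟩
      (V *ⱽ (W *ⱽ x)) i            ≈⟨ *ⱽ-assoc V W x i ⟨
      ((V *ᴹ W) *ⱽ x) i            ≈⟨ sum-cong-≋ {n} (λ k → *-congʳ (proj₁ (proj₂ inverse) i k)) ⟩
      (1ᴹ *ⱽ x) i                  ≈⟨ 1ᴹ-identity x i ⟩
      x i                          ∎
      where
      V : Matrix n
      V i j = v j i

      inverse : ∃[ W ] IsInverse V W
      inverse = independent⇒invertible {v = v} independent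

      W = proj₁ inverse

  -- Deflating the identity by the given `u` before anything else puts `μ` at the head of the list,
  -- the position that `IsVar` reserves for the eigenvalue 0. What remains has trace `n`.
  spectrum-exists : ∀ {n} {A : Matrix (suc n)} → SelfAdjoint A → ∀ {μ u} → NonZero u → Eigenvector A μ u →
                    ∃[ eig ] IsSpectrum A (μ ∷ⱽ eig)
  spectrum-exists {n} {A} A-adj {μ} {u} u≉0 Au≈μu =
    proj₁ rest , vector , orthogonal⇒basis nonZero orthogonal , eigenvector
    where
    identity : ReducingProjection A 1ᴹ
    identity = record
      { selfAdjoint = symmetric⇒selfAdjoint 1ᴹ-sym
      ; idempotent  = λ x → 1ᴹ-identity (1ᴹ *ⱽ x)
      ; commutes    = λ x i → trans (*ⱽ-cong A (1ᴹ-identity x) i) (sym (1ᴹ-identity (A *ⱽ x) i))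
      }

    open Deflation A-adj identity u≉0 (1ᴹ-identity u) Au≈μu

    trace≈ : trace deflated ≈ fromℕ n
    trace≈ = begin
      trace deflated              ≈⟨ deflated-trace ⟩
      trace {suc n} 1ᴹ - 1#       ≈⟨ +-congʳ (trans (sum-cong-≋ {suc n} λ i → 1ᴹ-diagonal {i = i} ≡.refl) (sum-replicate (suc n))) ⟩
      1# + fromℕ n - 1#           ≈⟨ solve 1 (λ x → con (+ 1) :+ x :- con (+ 1) := x) refl (fromℕ n) ⟩
      fromℕ n                     ∎

    rest : ∃[ eig ] EigenFamily A deflated eig
    rest = eigenFamily A-adj n reducing trace≈

    open EigenFamily (consFamily A-adj identity u≉0 (1ᴹ-identity u) Au≈μu (proj₂ rest))

  -- The basis in `IsSpectrum` is arbitrary, so `A` is diagonalised by conjugation: with `V` the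
  -- matrix of eigenvectors and `W` its inverse, `tr A = tr (A V W) = tr (W A V)`, and `A V` scales
  -- the columns of `V`.
  spectrum-trace : ∀ {n} {A : Matrix n} {eig} → IsSpectrum A eig → trace A ≈ sum eig
  spectrum-trace {n} {A} {eig} (v , (independent , _) , eigenvector) = begin
    trace A                                          ≈⟨ sum-cong-≋ {n} (λ i → sym (*ⱽ-column A i i)) ⟩
    trace (A *ᴹ 1ᴹ)                                  ≈⟨ sum-cong-≋ {n} (λ i → *ⱽ-cong A (λ k → sym (proj₁ (proj₂ inverse) k i)) i) ⟩
    trace (A *ᴹ (V *ᴹ W))                            ≈⟨ sum-cong-≋ {n} (λ i → *ᴹ-assoc A V W i i) ⟨
    trace ((A *ᴹ V) *ᴹ W)                            ≈⟨ trace-comm (A *ᴹ V) W ⟩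
    trace (W *ᴹ (A *ᴹ V))                            ≈⟨ sum-cong-≋ {n} (λ j → trans (dot-congʳ (W j) (eigenvector j)) (dot-scaleʳ (W j) (v j) (eig j))) ⟩
    sum (λ j → eig j * (W *ᴹ V) j j)                 ≈⟨ sum-cong-≋ {n} (λ j → trans (*-congˡ (trans (proj₂ (proj₂ inverse) j j) (1ᴹ-diagonal {i = j} ≡.refl))) (*-identityʳ _)) ⟩
    sum eig                                          ∎
    where
    V : Matrix n
    V i j = v j i

    inverse : ∃[ W ] IsInverse V W
    inverse = independent⇒invertible {v = v} independent

    W = proj₁ inverse

  spectrum-square : ∀ {n} {A : Matrix n} {eig} → IsSpectrum A eig → IsSpectrum (A *ᴹ A) (λ j → eig j ²)
  spectrum-square {n} {A} {eig} (v , basis , eigenvector) = v , basis , λ j i → begin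
    ((A *ᴹ A) *ⱽ v j) i               ≈⟨ *ⱽ-assoc A A (v j) i ⟩
    (A *ⱽ (A *ⱽ v j)) i               ≈⟨ *ⱽ-cong A (eigenvector j) i ⟩
    (A *ⱽ (λ i → eig j * v j i)) i    ≈⟨ dot-scaleʳ (A i) (v j) (eig j) ⟩
    eig j * (A *ⱽ v j) i              ≈⟨ *-congˡ (eigenvector j i) ⟩
    eig j * (eig j * v j i)           ≈⟨ *-assoc _ _ _ ⟨
    eig j ² * v j i                   ∎

  -- The variance in terms of traces

  variance-moments : ∀ {k} (x : Vector Carrier (suc k)) →
                     variance x ≈ sum (λ i → x i ²) / fromℕ (suc k) - (sum x / fromℕ (suc k)) ²
  variance-moments {k} x = begin
    sum (λ i → (x i - m) ²) / N                                      ≈⟨ *-congʳ (sum-cong-≋ {suc k} λ i → expand (x i)) ⟩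
    sum (λ i → (1# * x i ² - (m + m) * x i) + m ²) / N               ≈⟨ *-congʳ (trans (∑-distrib-+ {suc k} (λ i → 1# * x i ² - (m + m) * x i) (λ _ → m ²)) (+-cong (sum-linear (λ i → x i ²) x 1# (m + m)) constant)) ⟩
    ((1# * sum (λ i → x i ²) - (m + m) * sum x) + N * m ²) / N
      ≈⟨ solve 5 (λ Q m S N r → (con (+ 1) :* Q :- (m :+ m) :* S :+ N :* (m :* m)) :* r := Q :* r :- (m :+ m) :* (S :* r) :+ N :* r :* (m :* m)) refl _ m (sum x) N (N ⁻¹) ⟩
    sum (λ i → x i ²) / N - (m + m) * m + N / N * m ²                ≈⟨ +-congˡ (trans (*-congʳ (*-inverseʳ N (positive⇒≉0 (fromℕ-positive k)))) (*-identityˡ _)) ⟩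
    sum (λ i → x i ²) / N - (m + m) * m + m ²                        ≈⟨ solve 2 (λ a m → a :- (m :+ m) :* m :+ m :* m := a :- m :* m) refl _ m ⟩
    sum (λ i → x i ²) / N - m ²                                      ∎
    where
    N = fromℕ (suc k)
    m = mean x

    expand : ∀ y → (y - m) ² ≈ (1# * y ² - (m + m) * y) + m ²
    expand y = solve 2 (λ y m → (y :- m) :* (y :- m) := (con (+ 1) :* (y :* y) :- (m :+ m) :* y) :+ m :* m) refl y m

    constant : sum {suc k} (λ _ → m ²) ≈ N * m ²
    constant = trans (sum-cong-≋ {suc k} λ _ → sym (*-identityˡ (m ²)))
      (trans (sym (*-distribʳ-sum {suc k} (m ²) (λ _ → 1#))) (*-congʳ (sum-replicate (suc k))))

  -- The eigenvalue 0 at the head adds nothing to either trace, so sums over all n eigenvalues serve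
  -- for the n - 1 that are averaged; here n - 1 is `suc k`.
  variance-trace : ∀ {k} {A : Matrix (suc (suc k))} {eig} → IsSpectrum A (0# ∷ⱽ eig) →
                   variance eig ≈ trace (A *ᴹ A) / fromℕ (suc k) - (trace A / fromℕ (suc k)) ²
  variance-trace {k} {A} {eig} spectrum = trans (variance-moments eig)
    (+-cong (*-congʳ (sym tr²)) (-‿cong (*-cong tr tr)))
    where
    tr² : trace (A *ᴹ A) ≈ sum (λ i → eig i ²)
    tr² = trans (spectrum-trace {A = A *ᴹ A} (spectrum-square {A = A} spectrum)) (trans (+-congʳ (zeroˡ 0#)) (+-identityˡ _))
    tr : sum eig / fromℕ (suc k) ≈ trace A / fromℕ (suc k)
    tr = *-congʳ (sym (trans (spectrum-trace {A = A} spectrum) (+-identityˡ _)))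

  -- Sums over the vertices and edges of a graph

  -- Branches on `does` alone, the Boolean that `filter` inspects, so that a sum over a filtered
  -- list becomes a weighted sum.
  indicator : {P : Set} → Dec P → Carrier
  indicator P? = if does P? then 1# else 0#

  indicator-yes : ∀ {P : Set} (P? : Dec P) → P → indicator P? ≈ 1#
  indicator-yes (yes _) _ = refl
  indicator-yes (no ¬p) p = contradiction p ¬p

  indicator-no : ∀ {P : Set} (P? : Dec P) → ¬ P → indicator P? ≈ 0#
  indicator-no (yes p) ¬p = contradiction p ¬p
  indicator-no (no _) _ = refl

  indicator-cong : ∀ {P Q : Set} (P? : Dec P) (Q? : Dec Q) → (P → Q) → (Q → P) → indicator P? ≈ indicator Q?
  indicator-cong (yes p) Q? f g = sym (indicator-yes Q? (f p))
  indicator-cong (no ¬p) Q? f g = sym (indicator-no Q? (¬p ∘ g))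

  indicator-⊎ : ∀ {P Q : Set} (P? : Dec P) (Q? : Dec Q) → ¬ (P × Q) →
                indicator P? + indicator Q? ≈ indicator (P? ⊎-dec Q?)
  indicator-⊎ (yes p) (yes q) ¬pq = contradiction (p , q) ¬pq
  indicator-⊎ (yes p) (no _) _ = +-identityʳ 1#
  indicator-⊎ (no _) (yes _) _ = +-identityˡ 1#
  indicator-⊎ (no _) (no _) _ = +-identityˡ 0#

  1ᴹ-indicator : ∀ {n} (i j : Fin n) → 1ᴹ i j ≈ indicator (i Fin.≟ j)
  1ᴹ-indicator i j with i Fin.≟ j
  ... | yes _ = refl
  ... | no _ = refl

  adjacency-indicator : ∀ {n} (G : Graph n) i j → adjacencyMatrix G i j ≈ indicator (Graph.Adj? G i j)
  adjacency-indicator G i j with Graph.Adj? G i j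
  ... | yes _ = refl
  ... | no _ = refl

  listSum : ∀ {X : Set} → (X → Carrier) → List X → Carrier
  listSum g [] = 0#
  listSum g (x ∷ xs) = g x + listSum g xs

  listSum-cong : ∀ {X : Set} {g h : X → Carrier} → (∀ x → g x ≈ h x) → ∀ xs → listSum g xs ≈ listSum h xs
  listSum-cong p [] = refl
  listSum-cong p (x ∷ xs) = +-cong (p x) (listSum-cong p xs)

  listSum-lookup : ∀ {X : Set} (g : X → Carrier) xs → sum (λ e → g (lookup xs e)) ≈ listSum g xs
  listSum-lookup g [] = refl
  listSum-lookup g (x ∷ xs) = +-congˡ (listSum-lookup g xs)

  listSum-tabulate : ∀ {X : Set} {n} (g : X → Carrier) (f : Fin n → X) → listSum g (tabulate f) ≈ sum (λ i → g (f i))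
  listSum-tabulate {n = zero} g f = refl
  listSum-tabulate {n = suc n} g f = +-congˡ (listSum-tabulate g (f ∘ suc))

  listSum-filter : ∀ {X : Set} {P : Pred X _} (P? : Decidable P) (g : X → Carrier) xs →
                   listSum g (filter P? xs) ≈ listSum (λ x → indicator (P? x) * g x) xs
  listSum-filter P? g [] = refl
  listSum-filter P? g (x ∷ xs) with does (P? x)
  ... | true = +-cong (sym (*-identityˡ _)) (listSum-filter P? g xs)
  ... | false = trans (listSum-filter P? g xs) (sym (trans (+-congʳ (zeroˡ _)) (+-identityˡ _)))

  listSum-++ : ∀ {X : Set} (g : X → Carrier) xs ys → listSum g (xs ++ ys) ≈ listSum g xs + listSum g ys
  listSum-++ g [] ys = sym (+-identityˡ _)
  listSum-++ g (x ∷ xs) ys = trans (+-congˡ (listSum-++ g xs ys)) (sym (+-assoc _ _ _))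

  listSum-map : ∀ {X Y : Set} (g : Y → Carrier) (f : X → Y) xs → listSum g (List.map f xs) ≈ listSum (g ∘ f) xs
  listSum-map g f [] = refl
  listSum-map g f (x ∷ xs) = +-congˡ (listSum-map g f xs)

  listSum-cartesianProduct : ∀ {X Y : Set} (g : X × Y → Carrier) xs ys →
    listSum g (cartesianProduct xs ys) ≈ listSum (λ x → listSum (λ y → g (x , y)) ys) xs
  listSum-cartesianProduct g [] ys = refl
  listSum-cartesianProduct g (x ∷ xs) ys = trans (listSum-++ g (List.map (x ,_) ys) _)
    (+-cong (listSum-map g (x ,_) ys) (listSum-cartesianProduct g xs ys))

  fromℕ-length : ∀ {X : Set} (xs : List X) → fromℕ (length xs) ≈ listSum (λ _ → 1#) xs
  fromℕ-length [] = refl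
  fromℕ-length (x ∷ xs) = +-congˡ (fromℕ-length xs)

  unique⇒lookup-injective : ∀ {X : Set} {xs : List X} → Unique xs → ∀ i j → lookup xs i ≡ lookup xs j → i ≡ j
  unique⇒lookup-injective (_ ∷ _) zero zero _ = ≡.refl
  unique⇒lookup-injective (x∉xs ∷ _) zero (suc j) eq = contradiction eq (All.lookup x∉xs (∈-lookup j))
  unique⇒lookup-injective (x∉xs ∷ _) (suc i) zero eq = contradiction (≡.sym eq) (All.lookup x∉xs (∈-lookup i))
  unique⇒lookup-injective (_ ∷ u) (suc i) (suc j) eq = ≡.cong suc (unique⇒lookup-injective u i j eq)

  -- Edge sums and the incidence matrix

  module GraphSums {n} (G : Graph n) where
    open Graph G

    m : ℕ
    m = numEdges

    a : Matrix n
    a = adjacencyMatrix G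

    d : Vector Carrier n
    d u = sum (a u)

    fromℕ-degree : ∀ u → fromℕ (degree u) ≈ d u
    fromℕ-degree u = begin
      fromℕ (length (filter (Adj? u) (allFin n)))                ≈⟨ fromℕ-length (filter (Adj? u) (allFin n)) ⟩
      listSum (λ _ → 1#) (filter (Adj? u) (allFin n))            ≈⟨ listSum-filter (Adj? u) (λ _ → 1#) (allFin n) ⟩
      listSum (λ k → indicator (Adj? u k) * 1#) (allFin n)       ≈⟨ listSum-tabulate (λ k → indicator (Adj? u k) * 1#) (λ i → i) ⟩
      sum (λ k → indicator (Adj? u k) * 1#)                      ≈⟨ sum-cong-≋ {n} (λ k → trans (*-identityʳ _) (sym (adjacency-indicator G u k))) ⟩
      d u                                                        ∎

    a-sym : ∀ i j → a i j ≈ a j i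
    a-sym i j = trans (adjacency-indicator G i j)
      (trans (indicator-cong (Adj? i j) (Adj? j i) symm symm) (sym (adjacency-indicator G j i)))

    a-adj : ∀ {i j} → Adj i j → a i j ≈ 1#
    a-adj {i} {j} p = trans (adjacency-indicator G i j) (indicator-yes (Adj? i j) p)

    a-nonadj : ∀ {i j} → ¬ Adj i j → a i j ≈ 0#
    a-nonadj {i} {j} p = trans (adjacency-indicator G i j) (indicator-no (Adj? i j) p)

    a-diagonal : ∀ i → a i i ≈ 0#
    a-diagonal i = a-nonadj (irrefl ≡.refl)

    src tgt : Fin m → Fin n
    src e = proj₁ (lookup edges e)
    tgt e = proj₂ (lookup edges e)

    edge? : Decidable (λ ((i , j) : Fin n × Fin n) → i Fin.< j × Adj i j)
    edge? (i , j) = (i Fin.<? j) ×-dec Adj? i j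

    src<tgt : ∀ e → src e Fin.< tgt e
    src<tgt e = proj₁ (proj₂ (∈-filter⁻ edge? {xs = cartesianProduct (allFin n) (allFin n)} (∈-lookup {xs = edges} e)))

    edge-injective : ∀ {e f} → src e ≡ src f → tgt e ≡ tgt f → e ≡ f
    edge-injective {e} {f} p q = unique⇒lookup-injective
      (Unique.filter⁺ edge? (Unique.cartesianProduct⁺ (Unique.allFin⁺ n) (Unique.allFin⁺ n))) e f (≡.cong₂ _,_ p q)

    sum-edges : (g : Fin n → Fin n → Carrier) →
                sum (λ e → g (src e) (tgt e)) ≈ sum (λ i → sum λ j → indicator (edge? (i , j)) * g i j)
    sum-edges g = begin
      sum (λ e → g (src e) (tgt e))                              ≈⟨ listSum-lookup g′ edges ⟩
      listSum g′ edges                                           ≈⟨ listSum-filter edge? g′ (cartesianProduct (allFin n) (allFin n)) ⟩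
      listSum g″ (cartesianProduct (allFin n) (allFin n))        ≈⟨ listSum-cartesianProduct g″ (allFin n) (allFin n) ⟩
      listSum (λ i → listSum (λ j → g″ (i , j)) (allFin n)) (allFin n)
        ≈⟨ listSum-tabulate (λ i → listSum (λ j → g″ (i , j)) (allFin n)) (λ i → i) ⟩
      sum (λ i → listSum (λ j → g″ (i , j)) (allFin n))          ≈⟨ sum-cong-≋ {n} (λ i → listSum-tabulate (λ j → g″ (i , j)) (λ j → j)) ⟩
      sum (λ i → sum λ j → g″ (i , j))                           ∎
      where
      g′ g″ : Fin n × Fin n → Carrier
      g′ (i , j) = g i j
      g″ p = indicator (edge? p) * g′ p

    -- An edge is listed in exactly one of its two orientations: the order is asymmetric, and
    -- adjacency excludes `i = j`.
    orientations : ∀ i j → indicator (edge? (i , j)) + indicator (edge? (j , i)) ≈ a i j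
    orientations i j = trans (indicator-⊎ (edge? (i , j)) (edge? (j , i)) (λ ((p , _) , (q , _)) → Fin.<-asym p q))
      (trans (indicator-cong (edge? (i , j) ⊎-dec edge? (j , i)) (Adj? i j) [ proj₂ , symm ∘ proj₂ ]′ orient)
        (sym (adjacency-indicator G i j)))
      where
      orient : Adj i j → (i Fin.< j × Adj i j) ⊎ (j Fin.< i × Adj j i)
      orient p with Fin.<-cmp i j
      ... | tri< q _ _ = inj₁ (q , p)
      ... | tri≈ _ q _ = contradiction p (irrefl q)
      ... | tri> _ _ q = inj₂ (q , symm p)

    -- The passage between edges, which index the line graph, and ordered pairs of vertices, which
    -- index matrices. The degree sum, the row sums of the incidence matrix and the pairing with the
    -- Laplacian are all instances for particular `h`.
    sum-edges-symmetrised : (h : Fin n → Fin n → Carrier) →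
      sum (λ e → h (src e) (tgt e) + h (tgt e) (src e)) ≈ sum (λ i → sum λ j → a i j * h i j)
    sum-edges-symmetrised h = begin
      sum (λ e → h (src e) (tgt e) + h (tgt e) (src e))
        ≈⟨ ∑-distrib-+ {m} (λ e → h (src e) (tgt e)) (λ e → h (tgt e) (src e)) ⟩
      sum (λ e → h (src e) (tgt e)) + sum (λ e → h (tgt e) (src e))
        ≈⟨ +-cong (sum-edges h) (trans (sum-edges (λ i j → h j i)) (∑-comm (λ i j → indicator (edge? (i , j)) * h j i))) ⟩
      sum (λ i → sum (up i)) + sum (λ i → sum (down i))
        ≈⟨ ∑-distrib-+ {n} (λ i → sum (up i)) (λ i → sum (down i)) ⟨
      sum (λ i → sum (up i) + sum (down i))
        ≈⟨ sum-cong-≋ {n} (λ i → sym (∑-distrib-+ {n} (up i) (down i))) ⟩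
      sum (λ i → sum λ j → up i j + down i j)
        ≈⟨ sum-cong-≋ {n} (λ i → sum-cong-≋ {n} λ j → trans (sym (distribʳ _ _ _)) (*-congʳ (orientations i j))) ⟩
      sum (λ i → sum λ j → a i j * h i j) ∎
      where
      up down : Fin n → Fin n → Carrier
      up i j = indicator (edge? (i , j)) * h i j
      down i j = indicator (edge? (j , i)) * h i j

    handshake : sum d ≈ fromℕ (2 ℕ.* m)
    handshake = begin
      sum (λ i → sum (a i))                    ≈⟨ sum-cong-≋ {n} (λ i → sum-cong-≋ {n} λ j → sym (*-identityʳ (a i j))) ⟩
      sum (λ i → sum λ j → a i j * 1#)         ≈⟨ sum-edges-symmetrised (λ _ _ → 1#) ⟨
      sum {m} (λ _ → 1# + 1#)                  ≈⟨ ∑-distrib-+ {m} (λ _ → 1#) (λ _ → 1#) ⟩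
      sum {m} (λ _ → 1#) + sum {m} (λ _ → 1#)  ≈⟨ +-cong (sum-replicate m) (sum-replicate m) ⟩
      fromℕ m + fromℕ m                        ≈⟨ +-congˡ (sym (+-identityʳ _)) ⟩
      fromℕ m + (fromℕ m + 0#)                 ≈⟨ trans (fromℕ-+ m (m ℕ.+ 0)) (+-congˡ (fromℕ-+ m 0)) ⟨
      fromℕ (2 ℕ.* m)                          ∎

    incidence : Fin n → Vector Carrier m
    incidence u e = 1ᴹ u (src e) + 1ᴹ u (tgt e)

    incidence-sum : ∀ u → sum (incidence u) ≈ d u
    incidence-sum u = begin
      sum (incidence u)                        ≈⟨ sum-edges-symmetrised (λ i _ → 1ᴹ u i) ⟩
      sum (λ i → sum λ j → a i j * 1ᴹ u i)     ≈⟨ sum-cong-≋ {n} (λ i → trans (sym (*-distribʳ-sum {n} (1ᴹ u i) (a i))) (*-comm (d i) (1ᴹ u i))) ⟩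
      sum (λ i → 1ᴹ u i * d i)                 ≈⟨ sum-1ᴹˡ d u ⟩
      d u                                      ∎

    incidence-weighted : ∀ (f : Vector Carrier n) e → sum (λ u → incidence u e * f u) ≈ f (src e) + f (tgt e)
    incidence-weighted f e = begin
      sum (λ u → (1ᴹ u (src e) + 1ᴹ u (tgt e)) * f u)
        ≈⟨ sum-cong-≋ {n} (λ u → trans (*-congʳ (+-cong (1ᴹ-sym u (src e)) (1ᴹ-sym u (tgt e)))) (distribʳ _ _ _)) ⟩
      sum (λ u → 1ᴹ (src e) u * f u + 1ᴹ (tgt e) u * f u)
        ≈⟨ ∑-distrib-+ {n} (λ u → 1ᴹ (src e) u * f u) (λ u → 1ᴹ (tgt e) u * f u) ⟩
      sum (λ u → 1ᴹ (src e) u * f u) + sum (λ u → 1ᴹ (tgt e) u * f u)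
        ≈⟨ +-cong (sum-1ᴹˡ f (src e)) (sum-1ᴹˡ f (tgt e)) ⟩
      f (src e) + f (tgt e) ∎

    B : Matrix m
    B = adjacencyMatrix (lineGraph G)

    lineAdj? : ∀ e f → Dec (e ≢ f × ShareVertex (lookup edges e) (lookup edges f))
    lineAdj? = Graph.Adj? (lineGraph G)

    -- Four comparisons of end points count common vertices: two if the edges coincide, and at most
    -- one for distinct edges of a simple graph, so that the count is then the indicator of sharing
    -- a vertex.
    gram : ∀ e f → sum (λ u → incidence u e * incidence u f) ≈ (1# + 1#) * 1ᴹ e f + B e f
    gram e f = trans (incidence-weighted (λ u → incidence u f) e) (entry (e Fin.≟ f))
      where
      src≢tgt : ∀ {e} → src e ≢ tgt e
      src≢tgt {e} = Fin.<⇒≢ (src<tgt e)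

      entry : Dec (e ≡ f) → incidence (src e) f + incidence (tgt e) f ≈ (1# + 1#) * 1ᴹ e f + B e f
      entry (yes ≡.refl) = begin
        (1ᴹ s s + 1ᴹ s t) + (1ᴹ t s + 1ᴹ t t)
          ≈⟨ +-cong (+-cong (1ᴹ-diagonal {i = s} ≡.refl) (1ᴹ-offDiagonal (src≢tgt {e}))) (+-cong (1ᴹ-offDiagonal (src≢tgt {e} ∘ ≡.sym)) (1ᴹ-diagonal {i = t} ≡.refl)) ⟩
        (1# + 0#) + (0# + 1#)        ≈⟨ solve 0 ((con (+ 1) :+ con (+ 0)) :+ (con (+ 0) :+ con (+ 1)) := (con (+ 2)) :* con (+ 1) :+ con (+ 0)) refl ⟩
        (1# + 1#) * 1# + 0#          ≈⟨ +-cong (*-congˡ (1ᴹ-diagonal {i = e} ≡.refl)) (trans (adjacency-indicator (lineGraph G) e e) (indicator-no (lineAdj? e e) λ (e≢e , _) → e≢e ≡.refl)) ⟨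
        (1# + 1#) * 1ᴹ e e + B e e   ∎
        where
        s = src e
        t = tgt e
      entry (no e≢f) = begin
        (1ᴹ s s′ + 1ᴹ s t′) + (1ᴹ t s′ + 1ᴹ t t′)
          ≈⟨ +-cong (+-cong (1ᴹ-indicator s s′) (1ᴹ-indicator s t′)) (+-cong (1ᴹ-indicator t s′) (1ᴹ-indicator t t′)) ⟩
        (indicator (s Fin.≟ s′) + indicator (s Fin.≟ t′)) + (indicator (t Fin.≟ s′) + indicator (t Fin.≟ t′))
          ≈⟨ +-cong (indicator-⊎ (s Fin.≟ s′) (s Fin.≟ t′) (λ (p , q) → src≢tgt {f} (≡.trans (≡.sym p) q)))
                    (indicator-⊎ (t Fin.≟ s′) (t Fin.≟ t′) (λ (p , q) → src≢tgt {f} (≡.trans (≡.sym p) q))) ⟩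
        indicator ((s Fin.≟ s′) ⊎-dec (s Fin.≟ t′)) + indicator ((t Fin.≟ s′) ⊎-dec (t Fin.≟ t′))
          ≈⟨ indicator-⊎ ((s Fin.≟ s′) ⊎-dec (s Fin.≟ t′)) ((t Fin.≟ s′) ⊎-dec (t Fin.≟ t′)) disjoint ⟩
        indicator (shareVertex? (s , t) (s′ , t′))
          ≈⟨ indicator-cong (shareVertex? (s , t) (s′ , t′)) (lineAdj? e f) (e≢f ,_) proj₂ ⟩
        indicator (lineAdj? e f)      ≈⟨ adjacency-indicator (lineGraph G) e f ⟨
        B e f                         ≈⟨ trans (+-congʳ (trans (*-congˡ (1ᴹ-offDiagonal e≢f)) (zeroʳ _))) (+-identityˡ _) ⟨
        (1# + 1#) * 1ᴹ e f + B e f    ∎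
        where
        s = src e
        t = tgt e
        s′ = src f
        t′ = tgt f
        disjoint : ¬ ((s ≡ s′ ⊎ s ≡ t′) × (t ≡ s′ ⊎ t ≡ t′))
        disjoint (inj₁ p , inj₁ q) = src≢tgt {e} (≡.trans p (≡.sym q))
        disjoint (inj₁ p , inj₂ q) = e≢f (edge-injective p q)
        -- The edges would be each other's reversal, while both are listed with the smaller end
        -- first.
        disjoint (inj₂ p , inj₁ q) = Fin.<-asym (src<tgt f) (≡.subst₂ Fin._<_ p q (src<tgt e))
        disjoint (inj₂ p , inj₂ q) = src≢tgt {e} (≡.trans p (≡.sym q))

    -- Row `e` of KᵀK is summed in two ways: through `gram`, and as entry `e` of Kᵀ(K1), where K1 is
    -- the degree vector.
    lineGraph-degree : ∀ e → d (src e) + d (tgt e) ≈ (1# + 1#) + sum (B e)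
    lineGraph-degree e = begin
      d (src e) + d (tgt e)                                  ≈⟨ incidence-weighted d e ⟨
      sum (λ u → incidence u e * d u)                        ≈⟨ sum-cong-≋ {n} (λ u → trans (*-congˡ (sym (incidence-sum u))) (*-distribˡ-sum {m} (incidence u e) (incidence u))) ⟩
      sum (λ u → sum λ f → incidence u e * incidence u f)    ≈⟨ ∑-comm (λ u f → incidence u e * incidence u f) ⟩
      sum (λ f → sum λ u → incidence u e * incidence u f)    ≈⟨ sum-cong-≋ {m} (gram e) ⟩
      sum (λ f → (1# + 1#) * 1ᴹ e f + B e f)                 ≈⟨ ∑-distrib-+ {m} (λ f → (1# + 1#) * 1ᴹ e f) (B e) ⟩
      sum (λ f → (1# + 1#) * 1ᴹ e f) + sum (B e)             ≈⟨ +-congʳ (trans (sum-cong-≋ {m} λ f → *-comm (1# + 1#) (1ᴹ e f)) (sum-1ᴹˡ (λ _ → 1# + 1#) e)) ⟩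
      (1# + 1#) + sum (B e)                                  ∎

  -- The Laplacian as minimiser

  0<2 : 0# < 1# + 1#
  0<2 = +-positive 0<1 (inj₁ 0<1)

  -- Allows the pairing with the Laplacian to be stated doubled, with the integer factor r + 4 in
  -- place of its half.
  double-cancel : ∀ {x y} → x + x ≈ y + y → x ≈ y
  double-cancel {x} {y} p = begin
    x                ≈⟨ solve 2 (λ x y → x := y :+ (x :- y)) refl x y ⟩
    y + (x - y)      ≈⟨ +-congˡ (*-cancelˡ-zero (positive⇒≉0 0<2) (trans
                          (solve 2 (λ x y → con (+ 2) :* (x :- y) := (x :+ x) :- (y :+ y)) refl x y)
                          (trans (+-congʳ p) (-‿inverseʳ _)))) ⟩
    y + 0#           ≈⟨ +-identityʳ y ⟩
    y                ∎

  offDiagonal-sum : ∀ {n} (A : Matrix n) i (f : Vector Carrier n) → f i ≈ 0# →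
                    (∀ k → k ≢ i → A i k ≈ f k) → offDiagonalRowSum A i ≈ sum f
  offDiagonal-sum {n} A i f fi≈0 off = sum-cong-≋ {n} term≈
    where
    -- The summand of offDiagonalRowSum is local to its definition; it is recovered by unification.
    summand : ∃[ t ] offDiagonalRowSum A i ≡ sum t
    summand = _ , ≡.refl

    term≈ : ∀ k → proj₁ summand k ≈ f k
    term≈ k with k Fin.≟ i
    ... | yes ≡.refl = sym fi≈0
    ... | no k≢i = off k k≢i

  -- The inner product `tr (X Yᵀ)`, which on symmetric matrices is the trace of the product.
  frobenius : ∀ {n} → Matrix n → Matrix n → Carrier
  frobenius X Y = sum λ i → dot (X i) (Y i)

  frobenius-linearˡ : ∀ {n} (X Y Z : Matrix n) →
    frobenius (λ i j → X i j - 1# * Y i j) Z ≈ frobenius X Z - frobenius Y Z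
  frobenius-linearˡ {n} X Y Z = begin
    frobenius (λ i j → X i j - 1# * Y i j) Z
      ≈⟨ sum-cong-≋ {n} (λ i → trans (dot-linearˡ (X i) (Y i) (Z i) 1#) (+-congʳ (sym (*-identityˡ _)))) ⟩
    sum (λ i → 1# * dot (X i) (Z i) - 1# * dot (Y i) (Z i))
      ≈⟨ sum-linear (λ i → dot (X i) (Z i)) (λ i → dot (Y i) (Z i)) 1# 1# ⟩
    1# * frobenius X Z - 1# * frobenius Y Z
      ≈⟨ +-cong (*-identityˡ _) (-‿cong (*-identityˡ _)) ⟩
    frobenius X Z - frobenius Y Z ∎

  frobenius-comm : ∀ {n} (X Y : Matrix n) → frobenius X Y ≈ frobenius Y X
  frobenius-comm {n} X Y = sum-cong-≋ {n} λ i → dot-comm (X i) (Y i)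

  -- The squared distance, expanded with both mixed terms written as `frobenius Y X`: one evaluation
  -- of the pairing then settles both.
  frobenius-distance : ∀ {n} (X Y : Matrix n) →
    0# ≤ (frobenius X X - frobenius Y X) - (frobenius Y X - frobenius Y Y)
  frobenius-distance {n} X Y = ≤-respʳ expand (sum-nonneg {n} (λ i → dot-nonneg (D i)))
    where
    D : Matrix n
    D i j = X i j - 1# * Y i j
    expand : frobenius D D ≈ (frobenius X X - frobenius Y X) - (frobenius Y X - frobenius Y Y)
    expand = begin
      frobenius D D                                       ≈⟨ frobenius-linearˡ X Y D ⟩
      frobenius X D - frobenius Y D                       ≈⟨ +-cong (frobenius-comm X D) (-‿cong (frobenius-comm Y D)) ⟩
      frobenius D X - frobenius D Y                       ≈⟨ +-cong (frobenius-linearˡ X Y X) (-‿cong (trans (frobenius-linearˡ X Y Y) (+-congʳ (frobenius-comm X Y)))) ⟩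
      (frobenius X X - frobenius Y X) - (frobenius Y X - frobenius Y Y) ∎

  trace-square : ∀ {n} {A : Matrix n} → (∀ i j → A i j ≈ A j i) → trace (A *ᴹ A) ≈ frobenius A A
  trace-square {n} A-sym = sum-cong-≋ {n} λ i → sum-cong-≋ {n} λ k → *-congˡ (A-sym k i)

  module Laplacian {n} (G : Graph n) where
    open Graph G
    open GraphSums G

    L : Matrix n
    L i j = 1ᴹ i j * d i - a i j

    L-offDiagonal : ∀ {i j} → i ≢ j → L i j ≈ - a i j
    L-offDiagonal i≢j = trans (+-congʳ (trans (*-congʳ (1ᴹ-offDiagonal i≢j)) (zeroˡ _))) (+-identityˡ _)

    L-diagonal : ∀ i → L i i ≈ d i
    L-diagonal i = trans (+-cong (trans (*-congʳ (1ᴹ-diagonal {i = i} ≡.refl)) (*-identityˡ _))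
      (trans (-‿cong (a-diagonal i)) -0#≈0#)) (+-identityʳ _)

    -a≈aL : ∀ i k → - a i k ≈ a i k * L i k
    -a≈aL i k = by (Adj? i k)
      where
      by : Dec (Adj i k) → - a i k ≈ a i k * L i k
      by (yes p) = sym (trans (*-congʳ (a-adj p)) (trans (*-identityˡ _) (L-offDiagonal λ i≡k → irrefl i≡k p)))
      by (no ¬p) = trans (-‿cong (a-nonadj ¬p)) (trans -0#≈0# (sym (trans (*-congʳ (a-nonadj ¬p)) (zeroˡ _))))

    -- On `𝒮ᴸ G` this is the off-diagonal row sum; the factor `a i k` drops the diagonal and gives
    -- the form required by `sum-edges-symmetrised`.
    weight : Matrix n → Vector Carrier n
    weight A i = sum λ k → a i k * A i k

    offDiagonal≈weight : ∀ {A} → (∀ i j → i ≢ j → ¬ Adj i j → A i j ≈ 0#) → ∀ i → offDiagonalRowSum A i ≈ weight A i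
    offDiagonal≈weight {A} nonEdge i = offDiagonal-sum A i (λ k → a i k * A i k)
      (trans (*-congʳ (a-diagonal i)) (zeroˡ _)) λ k k≢i → by k (k≢i ∘ ≡.sym) (Adj? i k)
      where
      by : ∀ k → i ≢ k → Dec (Adj i k) → A i k ≈ a i k * A i k
      by k _ (yes p) = sym (trans (*-congʳ (a-adj p)) (*-identityˡ _))
      by k i≢k (no ¬p) = trans (nonEdge i k i≢k ¬p) (sym (trans (*-congʳ (a-nonadj ¬p)) (zeroˡ _)))

    weight-L : ∀ i → weight L i ≈ - d i
    weight-L i = begin
      sum (λ k → a i k * L i k)     ≈⟨ sum-cong-≋ {n} (λ k → trans (sym (-a≈aL i k)) (solve 1 (λ x → :- x := (:- con (+ 1)) :* x) refl (a i k))) ⟩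
      sum (λ k → - 1# * a i k)      ≈⟨ *-distribˡ-sum {n} (- 1#) (a i) ⟨
      - 1# * d i                    ≈⟨ solve 1 (λ x → (:- con (+ 1)) :* x := :- x) refl (d i) ⟩
      - d i                         ∎

    L-nonEdge : ∀ i j → i ≢ j → ¬ Adj i j → L i j ≈ 0#
    L-nonEdge i j i≢j ¬p = trans (L-offDiagonal i≢j) (trans (-‿cong (a-nonadj ¬p)) -0#≈0#)

    L-sym : ∀ i j → L i j ≈ L j i
    L-sym i j = by (i Fin.≟ j)
      where
      by : Dec (i ≡ j) → L i j ≈ L j i
      by (yes ≡.refl) = refl
      by (no i≢j) = trans (L-offDiagonal i≢j) (trans (-‿cong (a-sym i j)) (sym (L-offDiagonal (i≢j ∘ ≡.sym))))

    L∈𝒮ᴸˢ : 𝒮ᴸˢ G L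
    L∈𝒮ᴸˢ = record
      { symmetric = L-sym
      ; edge      = λ i j p → <-respˡ (sym (trans (L-offDiagonal λ i≡j → irrefl i≡j p) (-‿cong (a-adj p)))) -1<0
      ; nonEdge   = L-nonEdge
      ; diagonal  = λ i → trans (L-diagonal i) (trans (sym (-‿involutive _))
                      (-‿cong (sym (trans (offDiagonal≈weight {L} L-nonEdge i) (weight-L i)))))
      } , trans (sum-cong-≋ {n} L-diagonal) handshake
      where
      -1<0 : - 1# < 0#
      -1<0 = <-respʳ (-‿inverseˡ 1#) (<-respˡ (+-identityʳ _) (+-monoʳ-< (- 1#) 0<1))

    -- The product `0# * 1#` is kept so that this is literally an `Eigenvector` equation.
    L-kernel : ∀ i → (L *ⱽ λ _ → 1#) i ≈ 0# * 1#
    L-kernel i = begin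
      sum (λ j → L i j * 1#)                   ≈⟨ sum-cong-≋ {n} (λ j → solve 3 (λ o d a → (o :* d :- a) :* con (+ 1) := d :* o :- con (+ 1) :* a) refl (1ᴹ i j) (d i) (a i j)) ⟩
      sum (λ j → d i * 1ᴹ i j - 1# * a i j)    ≈⟨ sum-linear (1ᴹ i) (a i) (d i) 1# ⟩
      d i * sum (1ᴹ i) - 1# * d i              ≈⟨ +-congʳ (trans (*-congˡ (trans (sum-cong-≋ {n} λ j → sym (*-identityʳ (1ᴹ i j))) (sum-1ᴹˡ (λ _ → 1#) i))) (*-comm _ _)) ⟩
      1# * d i - 1# * d i                      ≈⟨ -‿inverseʳ _ ⟩
      0#                                       ≈⟨ zeroˡ 1# ⟨
      0# * 1#                                  ∎

  -- Graphs with regular line graph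

  module _ {n} (G : Graph n) {r : ℕ} (regular : Regular r (lineGraph G)) where
    open Graph G
    open GraphSums G
    open Laplacian G

    ρ : Carrier
    ρ = fromℕ r

    lineGraph-rowSum : ∀ e → sum (B e) ≈ ρ
    lineGraph-rowSum e = trans (sym (GraphSums.fromℕ-degree (lineGraph G) e)) (reflexive (≡.cong fromℕ (regular e)))

    edge-degrees : ∀ e → d (src e) + d (tgt e) ≈ (1# + 1#) + ρ
    edge-degrees e = trans (lineGraph-degree e) (+-congˡ (lineGraph-rowSum e))

    -- ⟨L , A⟩ is constant on 𝒮ᴸˢ G: both it and the trace are sums over the edges of the
    -- weight, with factors d(i) + d(j) + 2 = r + 4 and 2 respectively.
    frobenius-L : ∀ {A} → 𝒮ᴸ G A → frobenius L A + frobenius L A ≈ fromℕ (4 ℕ.+ r) * trace A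
    frobenius-L {A} A∈𝒮ᴸ = begin
      frobenius L A + frobenius L A                        ≈⟨ +-cong split split ⟩
      (- U - T) + (- U - T)                                ≈⟨ +-cong (+-cong (-‿cong U≈) (-‿cong T≈)) (+-cong (-‿cong U≈) (-‿cong T≈)) ⟩
      (- (((1# + 1#) + ρ) * E) - (E + E)) + (- (((1# + 1#) + ρ) * E) - (E + E))
        ≈⟨ solve 2 (λ r E → (:- ((con (+ 2) :+ r) :* E) :- (E :+ E)) :+ (:- ((con (+ 2) :+ r) :* E) :- (E :+ E))
                     := (con (+ 1) :+ (con (+ 1) :+ (con (+ 1) :+ (con (+ 1) :+ r)))) :* :- (E :+ E)) refl ρ E ⟩
      fromℕ (4 ℕ.+ r) * - (E + E)                          ≈⟨ *-congˡ (trans (-‿cong (sym T≈)) (sym trace≈)) ⟩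
      fromℕ (4 ℕ.+ r) * trace A                            ∎
      where
      open 𝒮ᴸ A∈𝒮ᴸ

      T U E : Carrier
      T = sum λ i → weight A i
      -- The diagonal contribution up to sign: `A i i` is minus the weight of row `i`, so
      -- `d i * A i i` can be spread over the edges at `i`.
      U = sum λ i → sum λ j → a i j * (d i * A i j)
      E = sum λ e → A (src e) (tgt e)

      diagonal≈ : ∀ i → A i i ≈ - weight A i
      diagonal≈ i = trans (diagonal i) (-‿cong (offDiagonal≈weight {A} nonEdge i))

      sum-neg : ∀ {k} (f : Vector Carrier k) → sum (λ i → - f i) ≈ - sum f
      sum-neg {k} f = begin
        sum (λ i → - f i)            ≈⟨ sum-cong-≋ {k} (λ i → solve 1 (λ x → :- x := (:- con (+ 1)) :* x) refl (f i)) ⟩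
        sum (λ i → - 1# * f i)       ≈⟨ *-distribˡ-sum {k} (- 1#) f ⟨
        - 1# * sum f                 ≈⟨ solve 1 (λ x → (:- con (+ 1)) :* x := :- x) refl (sum f) ⟩
        - sum f                      ∎

      trace≈ : trace A ≈ - T
      trace≈ = trans (sum-cong-≋ {n} diagonal≈) (sum-neg (weight A))

      T≈ : T ≈ E + E
      T≈ = begin
        T                                                     ≈⟨ sum-edges-symmetrised A ⟨
        sum (λ e → A (src e) (tgt e) + A (tgt e) (src e))     ≈⟨ sum-cong-≋ {m} (λ e → +-congˡ (symmetric (tgt e) (src e))) ⟩
        sum (λ e → A (src e) (tgt e) + A (src e) (tgt e))     ≈⟨ ∑-distrib-+ {m} (λ e → A (src e) (tgt e)) (λ e → A (src e) (tgt e)) ⟩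
        E + E                                                 ∎

      U≈ : U ≈ ((1# + 1#) + ρ) * E
      U≈ = begin
        U                                                     ≈⟨ sum-edges-symmetrised (λ i j → d i * A i j) ⟨
        sum (λ e → d (src e) * A (src e) (tgt e) + d (tgt e) * A (tgt e) (src e))
          ≈⟨ sum-cong-≋ {m} (λ e → trans (+-congˡ (*-congˡ (symmetric (tgt e) (src e)))) (trans (sym (distribʳ _ _ _)) (*-congʳ (edge-degrees e)))) ⟩
        sum (λ e → ((1# + 1#) + ρ) * A (src e) (tgt e))       ≈⟨ *-distribˡ-sum {m} ((1# + 1#) + ρ) (λ e → A (src e) (tgt e)) ⟨
        ((1# + 1#) + ρ) * E                                   ∎

      row : ∀ i → dot (L i) (A i) ≈ 1# * - sum (λ j → a i j * (d i * A i j)) - 1# * weight A i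
      row i = begin
        sum (λ j → (1ᴹ i j * d i - a i j) * A i j)
          ≈⟨ sum-cong-≋ {n} (λ j → solve 4 (λ o d a x → (o :* d :- a) :* x := d :* (o :* x) :- con (+ 1) :* (a :* x)) refl (1ᴹ i j) (d i) (a i j) (A i j)) ⟩
        sum (λ j → d i * (1ᴹ i j * A i j) - 1# * (a i j * A i j))
          ≈⟨ sum-linear (λ j → 1ᴹ i j * A i j) (λ j → a i j * A i j) (d i) 1# ⟩
        d i * sum (λ j → 1ᴹ i j * A i j) - 1# * weight A i
          ≈⟨ +-congʳ (*-congˡ (trans (sum-1ᴹˡ (A i) i) (diagonal≈ i))) ⟩
        d i * - weight A i - 1# * weight A i
          ≈⟨ +-congʳ (solve 2 (λ d w → d :* :- w := con (+ 1) :* :- (d :* w)) refl (d i) (weight A i)) ⟩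
        1# * - (d i * weight A i) - 1# * weight A i
          ≈⟨ +-congʳ (*-congˡ (-‿cong (trans (*-distribˡ-sum {n} (d i) (λ j → a i j * A i j))
               (sum-cong-≋ {n} λ j → solve 3 (λ d a x → d :* (a :* x) := a :* (d :* x)) refl (d i) (a i j) (A i j))))) ⟩
        1# * - sum (λ j → a i j * (d i * A i j)) - 1# * weight A i ∎

      split : frobenius L A ≈ - U - T
      split = begin
        frobenius L A  ≈⟨ sum-cong-≋ {n} row ⟩
        sum (λ i → 1# * - sum (λ j → a i j * (d i * A i j)) - 1# * weight A i)
          ≈⟨ sum-linear (λ i → - sum (λ j → a i j * (d i * A i j))) (weight A) 1# 1# ⟩
        1# * sum (λ i → - sum (λ j → a i j * (d i * A i j))) - 1# * T
          ≈⟨ +-cong (trans (*-identityˡ _) (sum-neg (λ i → sum (λ j → a i j * (d i * A i j))))) (-‿cong (*-identityˡ T)) ⟩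
        - U - T ∎

    -- The pairing identity at `A = L`, whose trace is the degree sum 2m.
    frobenius-LL : frobenius L L ≈ fromℕ (m ℕ.* (4 ℕ.+ r))
    frobenius-LL = double-cancel (begin
      frobenius L L + frobenius L L                     ≈⟨ frobenius-L {L} (proj₁ L∈𝒮ᴸˢ) ⟩
      c * trace L                                       ≈⟨ *-congˡ (proj₂ L∈𝒮ᴸˢ) ⟩
      c * fromℕ (2 ℕ.* m)                               ≈⟨ *-congˡ (fromℕ-* 2 m) ⟩
      c * ((1# + (1# + 0#)) * fromℕ m)                  ≈⟨ solve 2 (λ c m → c :* ((con (+ 1) :+ (con (+ 1) :+ con (+ 0))) :* m) := m :* c :+ m :* c) refl c (fromℕ m) ⟩
      fromℕ m * c + fromℕ m * c                         ≈⟨ +-cong (fromℕ-* m (4 ℕ.+ r)) (fromℕ-* m (4 ℕ.+ r)) ⟨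
      fromℕ (m ℕ.* (4 ℕ.+ r)) + fromℕ (m ℕ.* (4 ℕ.+ r)) ∎)
      where
      c = fromℕ (4 ℕ.+ r)

    frobenius-minimal : ∀ {A} → 𝒮ᴸˢ G A → frobenius L L ≤ frobenius A A
    frobenius-minimal {A} (A∈𝒮ᴸ , trace≈) = 0≤y-x⇒x≤y (≤-respʳ (begin
      (frobenius A A - frobenius L A) - (frobenius L A - frobenius L L)
        ≈⟨ +-cong (+-congˡ (-‿cong LA≈LL)) (-‿cong (+-congʳ LA≈LL)) ⟩
      (frobenius A A - frobenius L L) - (frobenius L L - frobenius L L)
        ≈⟨ solve 2 (λ a l → (a :- l) :- (l :- l) := a :- l) refl (frobenius A A) (frobenius L L) ⟩
      frobenius A A - frobenius L L ∎) (frobenius-distance A L))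
      where
      LA≈LL : frobenius L A ≈ frobenius L L
      LA≈LL = double-cancel (trans (frobenius-L A∈𝒮ᴸ)
        (trans (*-congˡ (trans trace≈ (sym (proj₂ L∈𝒮ᴸˢ)))) (sym (frobenius-L {L} (proj₁ L∈𝒮ᴸˢ)))))

    -- Invertibility of `M₂` and eligibility

    M₂-form : ∀ x → dot x (M₂ G *ⱽ x) ≈ (dot x x + dot x x) + sum (λ u → dot (incidence u) x ²)
    M₂-form x = begin
      dot x (M₂ G *ⱽ x)                                   ≈⟨ dot-congʳ x apply ⟩
      dot x (λ e → (1# + 1#) * x e - - 1# * (K *ⱽ x) e)   ≈⟨ dot-linearʳ x (λ e → (1# + 1#) * x e) (K *ⱽ x) (- 1#) ⟩
      dot x (λ e → (1# + 1#) * x e) - - 1# * dot x (K *ⱽ x)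
        ≈⟨ +-cong (dot-scaleʳ x x (1# + 1#)) (-‿cong (*-congˡ square)) ⟩
      (1# + 1#) * dot x x - - 1# * sum (λ u → dot (incidence u) x ²)
        ≈⟨ solve 2 (λ q s → con (+ 2) :* q :- (:- con (+ 1)) :* s := (q :+ q) :+ s) refl (dot x x) _ ⟩
      (dot x x + dot x x) + sum (λ u → dot (incidence u) x ²) ∎
      where
      -- The Gram matrix of the columns of the incidence matrix, not the incidence matrix itself.
      K : Matrix m
      K e f = sum λ u → incidence u e * incidence u f

      entry : ∀ e f → M₂ G e f * x f ≈ (1# + 1#) * (1ᴹ e f * x f) - - 1# * (K e f * x f)
      entry e f = trans
        (solve 3 (λ o b x → ((con (+ 1) :+ (con (+ 1) :+ (con (+ 1) :+ (con (+ 1) :+ con (+ 0))))) :* o :+ b) :* x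
          := con (+ 2) :* (o :* x) :- (:- con (+ 1)) :* ((con (+ 2) :* o :+ b) :* x)) refl (1ᴹ e f) (B e f) (x f))
        (+-congˡ (-‿cong (*-congˡ (*-congʳ (sym (gram e f))))))

      apply : M₂ G *ⱽ x ≈ⱽ λ e → (1# + 1#) * x e - - 1# * (K *ⱽ x) e
      apply e = trans (sum-cong-≋ {m} (entry e)) (trans
        (sum-linear (λ f → 1ᴹ e f * x f) (λ f → K e f * x f) (1# + 1#) (- 1#))
        (+-congʳ (*-congˡ (sum-1ᴹˡ x e))))

      square : dot x (K *ⱽ x) ≈ sum (λ u → dot (incidence u) x ²)
      square = begin
        sum (λ e → x e * sum (λ f → K e f * x f))
          ≈⟨ sum-cong-≋ {m} (λ e → *-congˡ (factor e)) ⟩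
        sum (λ e → x e * sum (λ u → incidence u e * dot (incidence u) x))
          ≈⟨ sum-cong-≋ {m} (λ e → *-distribˡ-sum {n} (x e) (λ u → incidence u e * dot (incidence u) x)) ⟩
        sum (λ e → sum λ u → x e * (incidence u e * dot (incidence u) x))
          ≈⟨ ∑-comm (λ e u → x e * (incidence u e * dot (incidence u) x)) ⟩
        sum (λ u → sum λ e → x e * (incidence u e * dot (incidence u) x))
          ≈⟨ sum-cong-≋ {n} (λ u → trans (sum-cong-≋ {m} λ e → solve 3 (λ x i y → x :* (i :* y) := i :* x :* y) refl (x e) (incidence u e) (dot (incidence u) x))
               (sym (*-distribʳ-sum {m} (dot (incidence u) x) (λ e → incidence u e * x e)))) ⟩
        sum (λ u → dot (incidence u) x ²) ∎
        where
        factor : ∀ e → sum (λ f → K e f * x f) ≈ sum (λ u → incidence u e * dot (incidence u) x)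
        factor e = begin
          sum (λ f → K e f * x f)
            ≈⟨ sum-cong-≋ {m} (λ f → *-distribʳ-sum {n} (x f) (λ u → incidence u e * incidence u f)) ⟩
          sum (λ f → sum λ u → incidence u e * incidence u f * x f)
            ≈⟨ ∑-comm (λ f u → incidence u e * incidence u f * x f) ⟩
          sum (λ u → sum λ f → incidence u e * incidence u f * x f)
            ≈⟨ sum-cong-≋ {n} (λ u → trans (sum-cong-≋ {m} λ f → *-assoc (incidence u e) (incidence u f) (x f))
                 (sym (*-distribˡ-sum {m} (incidence u e) (λ f → incidence u f * x f)))) ⟩
          sum (λ u → incidence u e * dot (incidence u) x) ∎

    M₂-invertible : ∃[ N ] IsInverse (M₂ G) N
    M₂-invertible = [ (λ (x , x≉0 , M₂x≈0) → contradiction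
        (trans (sym (M₂-form x)) (sum-zero {m} λ e → trans (*-congˡ (M₂x≈0 e)) (zeroʳ _)))
        (positive⇒≉0 (+-positive (+-positive (dot-positive x≉0) (dot-nonneg x)) (sum-nonneg {n} λ u → ²-nonneg (dot (incidence u) x)))))
      , (λ N → N) ]′ (singular-or-invertible (M₂ G))

    M₂-rowSum : ∀ e → (M₂ G *ⱽ λ _ → 1#) e ≈ fromℕ (4 ℕ.+ r)
    M₂-rowSum e = begin
      sum (λ f → (fromℕ 4 * 1ᴹ e f + B e f) * 1#)
        ≈⟨ sum-cong-≋ {m} (λ f → solve 3 (λ c o b → (c :* o :+ b) :* con (+ 1) := c :* (o :* con (+ 1)) :- (:- con (+ 1)) :* b) refl (fromℕ 4) (1ᴹ e f) (B e f)) ⟩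
      sum (λ f → fromℕ 4 * (1ᴹ e f * 1#) - - 1# * B e f)
        ≈⟨ sum-linear (λ f → 1ᴹ e f * 1#) (B e) (fromℕ 4) (- 1#) ⟩
      fromℕ 4 * sum (λ f → 1ᴹ e f * 1#) - - 1# * sum (B e)
        ≈⟨ +-cong (*-congˡ (sum-1ᴹˡ (λ _ → 1#) e)) (-‿cong (*-congˡ (lineGraph-rowSum e))) ⟩
      fromℕ 4 * 1# - - 1# * ρ
        ≈⟨ solve 2 (λ c r → c :* con (+ 1) :- (:- con (+ 1)) :* r := c :+ r) refl (fromℕ 4) ρ ⟩
      fromℕ 4 + ρ
        ≈⟨ fromℕ-+ 4 r ⟨
      fromℕ (4 ℕ.+ r) ∎

    -- Since the all-ones vector is an eigenvector of `M₂` for 4 + r, the inverse maps it to 1/(4 +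
    -- r) times itself.
    eligible : Eligible G
    eligible = N , proj₂ M₂-invertible , λ e → <-respʳ (value e) (⁻¹-positive (fromℕ-positive (3 ℕ.+ r)))
      where
      N = proj₁ M₂-invertible
      c = fromℕ (4 ℕ.+ r)
      1ⱽ : Vector Carrier m
      1ⱽ _ = 1#

      scaled : ∀ e → c * (N *ⱽ 1ⱽ) e ≈ 1#
      scaled e = begin
        c * (N *ⱽ 1ⱽ) e               ≈⟨ dot-scaleʳ (N e) 1ⱽ c ⟨
        (N *ⱽ (λ _ → c * 1#)) e       ≈⟨ *ⱽ-cong N (λ f → trans (*-identityʳ c) (sym (M₂-rowSum f))) e ⟩
        (N *ⱽ (M₂ G *ⱽ 1ⱽ)) e         ≈⟨ *ⱽ-assoc N (M₂ G) 1ⱽ e ⟨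
        ((N *ᴹ M₂ G) *ⱽ 1ⱽ) e         ≈⟨ sum-cong-≋ {m} (λ k → *-congʳ (proj₂ (proj₂ M₂-invertible) e k)) ⟩
        (1ᴹ *ⱽ 1ⱽ) e                  ≈⟨ 1ᴹ-identity 1ⱽ e ⟩
        1#                            ∎

      value : ∀ e → c ⁻¹ ≈ (N *ⱽ 1ⱽ) e
      value e = begin
        c ⁻¹                          ≈⟨ *-identityʳ _ ⟨
        c ⁻¹ * 1#                     ≈⟨ *-congˡ (scaled e) ⟨
        c ⁻¹ * (c * (N *ⱽ 1ⱽ) e)      ≈⟨ solve 3 (λ i c y → i :* (c :* y) := c :* i :* y) refl (c ⁻¹) c _ ⟩
        c * c ⁻¹ * (N *ⱽ 1ⱽ) e        ≈⟨ *-congʳ (*-inverseʳ c (positive⇒≉0 (fromℕ-positive (3 ℕ.+ r)))) ⟩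
        1# * (N *ⱽ 1ⱽ) e              ≈⟨ *-identityˡ _ ⟩
        (N *ⱽ 1ⱽ) e                   ∎

  -- The minimum variance

  module _ {k} (G : Graph (suc (suc k))) {r : ℕ} (regular : Regular r (lineGraph G)) where
    open Laplacian G
    m : ℕ
    m = Graph.numEdges G

    minimumVariance : Carrier
    minimumVariance = fromℕ (m ℕ.* (4 ℕ.+ r)) / fromℕ (suc k) - (fromℕ (2 ℕ.* m) / fromℕ (suc k)) ²

    variance-frobenius : ∀ {A} → 𝒮ᴸˢ G A → ∀ {eig} → IsSpectrum A (0# ∷ⱽ eig) →
      variance eig ≈ frobenius A A / fromℕ (suc k) - (fromℕ (2 ℕ.* m) / fromℕ (suc k)) ²
    variance-frobenius {A} (A∈𝒮ᴸ , trace≈) spectrum = trans (variance-trace {A = A} spectrum)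
      (+-cong (*-congʳ (trace-square (𝒮ᴸ.symmetric A∈𝒮ᴸ))) (-‿cong (*-cong (*-congʳ trace≈) (*-congʳ trace≈))))

    -- The value is attained at `L`, so a lower bound `b` is compared with it by evaluating
    -- `b-lower` there. For an arbitrary `A` the variance is an increasing function of
    -- `frobenius A A`, as the trace is fixed.
    isMV : IsMV G minimumVariance
    isMV = lower , λ b b-lower → b-lower minimumVariance (L , L∈𝒮ᴸˢ , proj₁ spectrum , proj₂ spectrum ,
        sym (trans (variance-frobenius L∈𝒮ᴸˢ (proj₂ spectrum)) (+-congʳ (*-congʳ (frobenius-LL G regular)))))
      where
      spectrum : ∃[ eig ] IsSpectrum L (0# ∷ⱽ eig)
      spectrum = spectrum-exists {A = L} (symmetric⇒selfAdjoint {A = L} L-sym) {u = λ _ → 1#} (zero , 0≉1 ∘ sym) L-kernel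

      lower : LowerBound (λ v → ∃[ A ] 𝒮ᴸˢ G A × IsVar A v) minimumVariance
      lower v (A , A∈𝒮ᴸˢ , eig , spec , v≈) = ≤-respʳ (sym (trans v≈ (variance-frobenius A∈𝒮ᴸˢ spec)))
        (0≤y-x⇒x≤y (≤-respʳ
          (solve 4 (λ a l i s → i :* (a :- l) := (a :* i :- s) :- (l :* i :- s)) refl (frobenius A A) _ (fromℕ (suc k) ⁻¹) _)
          (*-nonneg (inj₁ (⁻¹-positive (fromℕ-positive k)))
            (x≤y⇒0≤y-x (≤-respˡ (frobenius-LL G regular) (frobenius-minimal G regular A∈𝒮ᴸˢ))))))

proposition4p7 :
    (ℝ : CompleteOrderedField) →
    let open CompleteOrderedField ℝ
        open MinimumVariance ℝ in
    (n-1 : ℕ) (G : Graph (suc n-1)) →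
    let m = Graph.numEdges G in
    2 ℕ.≤ suc n-1 →
    1 ℕ.≤ m →
    (r : ℕ) → Regular r (lineGraph G) →
    Eligible G ×
    IsMV G (fromℕ (m ℕ.* (4 ℕ.+ r)) / fromℕ n-1 - (fromℕ (2 ℕ.* m) / fromℕ n-1) ²)
-- The bound 2 ≤ n excludes n - 1 = 0, a divisor about whose inverse nothing is known.
proposition4p7 ℝ zero G (s≤s ()) _ r regular
proposition4p7 ℝ (suc k) G _ _ r regular = Theory.eligible ℝ G regular , Theory.isMV ℝ G regular
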